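{- Let $q$ be a prime power and let $L_U$ be a linear set of $\mathrm{PG}(1,q^5)$ belonging to one of the families $(C3)$ or $(C4)$ (defined in the context). Then there exist $\varepsilon\in\{0,1\}$ and $\gamma\in\mathbb{F}_{q^5}^*$ such that $L_U$ is projectively equivalent to $L^\varepsilon_\gamma:=L_{W^\varepsilon_\gamma}$, where \[ W^0_\gamma=\{(x,x^q+\gamma h): x\in\mathbb{F}_{q^5},\ \mathrm{Tr}_{q^5/q}(x)=0,\ h\in\mathbb{F}_q\} \] and \[ W^1_\gamma=\{(x,x^q+\gamma\,\mathrm{Tr}_{q^5/q}(x)): x\in\mathbb{F}_{q^5}\}. \]
   Context: For an $\mathbb{F}_q$-subspace $U$ of $\mathbb{F}_{q^5}^2$, $L_U=\{\langle \mathbf{u}\rangle_{\mathbb{F}_{q^5}}:\mathbf{u}\in U\setminus\{\mathbf 0\}\}\subseteq\mathrm{PG}(1,q^5)$ is the $\mathbb{F}_q$-linear set defined by $U$. Two linear sets are projectively equivalent if an element of $\mathrm{PGL}(2,q^5)$ maps one (as a point set) onto the other. $\mathrm{Tr}_{q^5/q}(x)=x+x^q+x^{q^2}+x^{q^3}+x^{q^4}$ and $\mathrm{N}_{q^5/q}(x)=x^{1+q+q^2+q^3+q^4}$. Family $(C3)$: the linear sets $L_U$ with $U=\{(\eta(x^q-x)+\mathrm{Tr}_{q^5/q}(\rho x),\ x^q-x^{q^4}):x\in\mathbb{F}_{q^5}\}$, where $\eta,\rho\in\mathbb{F}_{q^5}^*$ and $\mathrm{Tr}_{q^5/q}(\eta)=0\ne\mathrm{Tr}_{q^5/q}(\rho)$.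 Family $(C4)$: the linear sets $L_U$ with $U=\{(x,\ k(x^q+x^{q^3})+x^{q^2}+x^{q^4}):x\in\mathbb{F}_{q^5}\}$, where $k\in\mathbb{F}_{q^5}$, $\mathrm{N}_{q^5/q}(k)=1$ and $k\neq1$. -}

module Defs where

open import Algebra.Bundles using (CommutativeRing)
import Algebra.Properties.Ring as RingProperties
import Algebra.Properties.Semiring.Exp as Exp
import Algebra.Solver.Ring.NaturalCoefficients.Default as NaturalCoefficients
open import Data.Fin.Base using (Fin; zero; suc)
open import Data.Nat.Base as ℕ using (ℕ)
open import Data.Nat.Primality using (Prime)
open import Data.Product.Base using (∃; ∃₂; _×_; _,_; proj₁; proj₂)
open import Function.Bundles using (Inverse)
open import Level using (Level; _⊔_) renaming (suc to lsuc)
open import Relation.Binary.PropositionalEquality as ≡ using (_≡_)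
import Relation.Binary.Reasoning.Setoid as ≈-Reasoning
open import Relation.Nullary.Negation using (¬_)
open import Relation.Unary using (Pred; _∈_; _≐_)

IsPrimePower : Pred ℕ _
IsPrimePower q = ∃₂ λ p e → Prime p × q ≡ p ℕ.^ ℕ.suc e

record IsField {c ℓ : Level} (R : CommutativeRing c ℓ) : Set (c ⊔ ℓ) where
  open CommutativeRing R
  field
    1≉0     : ¬ 1# ≈ 0#
    inverse : ∀ x → ¬ x ≈ 0# → ∃ λ y → x * y ≈ 1#

record FiniteField (c ℓ : Level) (n : ℕ) : Set (lsuc (c ⊔ ℓ)) where
  field
    commutativeRing : CommutativeRing c ℓ
    isField         : IsField commutativeRing
    enumeration     : Inverse (CommutativeRing.setoid commutativeRing) (≡.setoid (Fin n))
  open CommutativeRing commutativeRing public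
  open IsField isField public

private
  module Cramer {c ℓ : Level} (R : CommutativeRing c ℓ) where
    open CommutativeRing R
    open NaturalCoefficients commutativeSemiring

    first : ∀ a b c d x y →
      a * d * x + b * (c * x + d * y) ≈ d * (a * x + b * y) + b * c * x
    first = solve 6 (λ a b c d x y →
      a :* d :* x :+ b :* (c :* x :+ d :* y) := d :* (a :* x :+ b :* y) :+ b :* c :* x) refl

    second : ∀ a b c d x y →
      a * d * y + c * (a * x + b * y) ≈ a * (c * x + d * y) + b * c * y
    second = solve 6 (λ a b c d x y →
      a :* d :* y :+ c :* (a :* x :+ b :* y) := a :* (c :* x :+ d :* y) :+ b :* c :* y) refl

module LinearSets {c ℓ : Level} (q : ℕ) (F : FiniteField c ℓ (q ℕ.^ 5)) where

  open FiniteField F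
  open Exp semiring using (_^_)

  -- 𝔽_q is the unique subfield of order q of 𝔽_{q⁵}, i.e. the set of roots of X^q − X.
  𝔽q : Pred Carrier ℓ
  𝔽q x = x ^ q ≈ x

  Tr : Carrier → Carrier
  Tr x = x + x ^ q + x ^ (q ℕ.^ 2) + x ^ (q ℕ.^ 3) + x ^ (q ℕ.^ 4)

  N : Carrier → Carrier
  N x = x ^ (1 ℕ.+ q ℕ.+ q ℕ.^ 2 ℕ.+ q ℕ.^ 3 ℕ.+ q ℕ.^ 4)

  Vector : Set c
  Vector = Carrier × Carrier

  infix 4 _≈ᵥ_
  _≈ᵥ_ : Vector → Vector → Set ℓ
  (x , y) ≈ᵥ (x′ , y′) = x ≈ x′ × y ≈ y′

  0ᵥ : Vector
  0ᵥ = 0# , 0#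

  infixr 7 _·ᵥ_
  _·ᵥ_ : Carrier → Vector → Vector
  s ·ᵥ (x , y) = s * x , s * y

  -- PG(1,q⁵): the point ⟨v⟩ is represented by the nonzero vector v, and
  -- equality of points is proportionality _∼_.
  record Point : Set (c ⊔ ℓ) where
    constructor ⟨_∣_⟩
    field
      vector  : Vector
      nonzero : ¬ vector ≈ᵥ 0ᵥ
  open Point public

  infix 4 _∼_
  _∼_ : Point → Point → Set (c ⊔ ℓ)
  P ∼ Q = ∃ λ s → ¬ s ≈ 0# × vector P ≈ᵥ s ·ᵥ vector Q

  PointSet : Set (lsuc (c ⊔ ℓ))
  PointSet = Pred Point (c ⊔ ℓ)

  L : Pred Vector (c ⊔ ℓ) → PointSet
  L U P = ∃ λ u → u ∈ U × (∃ λ u≉0 → P ∼ ⟨ u ∣ u≉0 ⟩)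

  -- An element of PGL(2,q⁵) is given by any invertible matrix representing it;
  -- proportional matrices act on points in the same way.
  record PGL₂ : Set (c ⊔ ℓ) where
    field
      m₁₁ m₁₂ m₂₁ m₂₂ : Carrier
      det≉0           : ¬ m₁₁ * m₂₂ - m₁₂ * m₂₁ ≈ 0#

    applyᵥ : Vector → Vector
    applyᵥ (x , y) = m₁₁ * x + m₁₂ * y , m₂₁ * x + m₂₂ * y

    private
      det : Carrier
      det = m₁₁ * m₂₂ - m₁₂ * m₂₁

      det-cancel : ∀ z s t {u v} → u ≈ 0# → v ≈ 0# →
        m₁₁ * m₂₂ * z + s * u ≈ t * v + m₁₂ * m₂₁ * z → z ≈ 0#
      det-cancel z s t {u} {v} u≈0 v≈0 eq = begin
        z              ≈⟨ *-identityˡ z ⟨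
        1# * z         ≈⟨ *-congʳ det*e≈1 ⟨
        det * e * z    ≈⟨ *-congʳ (*-comm det e) ⟩
        e * det * z    ≈⟨ *-assoc e det z ⟩
        e * (det * z)  ≈⟨ *-congˡ det*z≈0 ⟩
        e * 0#         ≈⟨ zeroʳ e ⟩
        0#             ∎
        where
        open ≈-Reasoning setoid
        e       = proj₁ (inverse det det≉0)
        det*e≈1 = proj₂ (inverse det det≉0)
        diag≈anti : m₁₁ * m₂₂ * z ≈ m₁₂ * m₂₁ * z
        diag≈anti = begin
          m₁₁ * m₂₂ * z            ≈⟨ +-identityʳ _ ⟨
          m₁₁ * m₂₂ * z + 0#       ≈⟨ +-congˡ (trans (*-congˡ u≈0) (zeroʳ s)) ⟨
          m₁₁ * m₂₂ * z + s * u    ≈⟨ eq ⟩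
          t * v + m₁₂ * m₂₁ * z    ≈⟨ +-congʳ (trans (*-congˡ v≈0) (zeroʳ t)) ⟩
          0# + m₁₂ * m₂₁ * z       ≈⟨ +-identityˡ _ ⟩
          m₁₂ * m₂₁ * z            ∎
        det*z≈0 : det * z ≈ 0#
        det*z≈0 = begin
          det * z                          ≈⟨ RingProperties.[y-z]x≈yx-zx ring z _ _ ⟩
          m₁₁ * m₂₂ * z - m₁₂ * m₂₁ * z    ≈⟨ +-congʳ diag≈anti ⟩
          m₁₂ * m₂₁ * z - m₁₂ * m₂₁ * z    ≈⟨ -‿inverseʳ _ ⟩
          0#                               ∎

    applyᵥ-nonzero : ∀ v → ¬ v ≈ᵥ 0ᵥ → ¬ applyᵥ v ≈ᵥ 0ᵥ
    applyᵥ-nonzero (x , y) v≉0 (r≈0 , s≈0) = v≉0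
      ( det-cancel x m₁₂ m₂₂ s≈0 r≈0 (Cramer.first commutativeRing m₁₁ m₁₂ m₂₁ m₂₂ x y)
      , det-cancel y m₂₁ m₁₁ r≈0 s≈0 (Cramer.second commutativeRing m₁₁ m₁₂ m₂₁ m₂₂ x y) )

    apply : Point → Point
    apply P = ⟨ applyᵥ (vector P) ∣ applyᵥ-nonzero (vector P) (nonzero P) ⟩

  image : PGL₂ → PointSet → PointSet
  image φ X Q = ∃ λ P → P ∈ X × Q ∼ PGL₂.apply φ P

  ProjectivelyEquivalent : PointSet → PointSet → Set (c ⊔ ℓ)
  ProjectivelyEquivalent X Y = ∃ λ φ → image φ X ≐ Y

  U₃ : (η ρ : Carrier) → Pred Vector (c ⊔ ℓ)
  U₃ η ρ u = ∃ λ x → u ≈ᵥ (η * (x ^ q - x) + Tr (ρ * x) , x ^ q - x ^ (q ℕ.^ 4))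

  C3 : Pred PointSet (c ⊔ ℓ)
  C3 X = ∃₂ λ η ρ →
    ¬ η ≈ 0# × ¬ ρ ≈ 0# × Tr η ≈ 0# × ¬ Tr ρ ≈ 0# × X ≐ L (U₃ η ρ)

  U₄ : (k : Carrier) → Pred Vector (c ⊔ ℓ)
  U₄ k u = ∃ λ x →
    u ≈ᵥ (x , k * (x ^ q + x ^ (q ℕ.^ 3)) + x ^ (q ℕ.^ 2) + x ^ (q ℕ.^ 4))

  C4 : Pred PointSet (c ⊔ ℓ)
  C4 X = ∃ λ k → N k ≈ 1# × ¬ k ≈ 1# × X ≐ L (U₄ k)

  W : (ε : Fin 2) (γ : Carrier) → Pred Vector (c ⊔ ℓ)
  W zero       γ u = ∃₂ λ x h → Tr x ≈ 0# × h ∈ 𝔽q × u ≈ᵥ (x , x ^ q + γ * h)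
  W (suc zero) γ u = ∃ λ x → u ≈ᵥ (x , x ^ q + γ * Tr x)

{-# OPTIONS --safe #-}
-- Write σ x = x^q. Both families are brought to the form {(x, σ x + δ h) : h ∈ 𝔽_q, Tr x = θ h} with δ ≠ 0
-- and θ ∈ 𝔽_q, which is W⁰ with γ = δ if θ = 0, and W¹ with γ = δ / θ otherwise.
--
-- For (C4) a projectivity built from a solution of k σ a = a (Hilbert's theorem 90) does this to U itself.
-- For (C3) one first replaces U by its orthogonal complement U⊥ for the form Tr (u₁ v₂ − u₂ v₁), which
-- defines the same linear set: a point lies in L_U iff a certain additive map of the field has a nonzero
-- kernel, it lies in L_{U⊥} iff the adjoint map has one, and an additive map of a finite field is injective
-- iff its adjoint is.
module Submission where

open import Algebra.Bundles using (CommutativeRing; CommutativeMonoid)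
import Algebra.Properties.CommutativeMonoid.Sum as MonoidSum
import Algebra.Properties.CommutativeSemiring.Binomial as Binomial
import Algebra.Properties.CommutativeSemiring.Exp as CommutativeExp
import Algebra.Properties.Ring as RingProperties
import Algebra.Properties.Semiring.Mult as SemiringMult
import Algebra.Solver.Ring as RingSolver
open import Algebra.Solver.Ring.AlmostCommutativeRing using (fromCommutativeRing; _-Raw-AlmostCommutative⟶_)
open import Data.Empty using (⊥-elim)
open import Data.Fin.Base using (Fin; zero; suc; fromℕ; inject₁; inject≤; punchIn; punchOut)
open import Data.Fin.Permutation using (Permutation′; permutation)
open import Data.Fin.Properties using (any?; punchInᵢ≢i; <⇒notInjective; inject≤-injective; punchOut-injective; toℕ-fromℕ; toℕ-inject₁; toℕ<n)
import Data.Fin.Properties as Fin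
open import Data.Integer.Base as ℤ using (ℤ; +_; -[1+_])
import Data.Integer.Properties as ℤ
open import Data.Maybe.Base using (Maybe)
import Data.Maybe.Base as Maybe
open import Data.Nat.Base as ℕ using (ℕ; zero; suc; z<s; s<s; NonZero)
open import Data.Nat.Combinatorics using (_C_; nCn≡1; nCk≡n!/k![n-k]!; k![n∸k]!∣n!)
open import Data.Nat.DivMod using (m/n*n≡m)
open import Data.Nat.Divisibility using (_∣_; divides; m∣m*n; >⇒∤)
open import Data.Nat.Primality using (Prime; prime⇒nonZero; prime⇒nonTrivial; euclidsLemma)
import Data.Nat.Properties as ℕ
open import Data.Product.Base using (∃; ∃₂; Σ; _×_; _,_; proj₁; proj₂)
open import Data.Sum.Base using (_⊎_; inj₁; inj₂)
open import Function.Base using (_∘_)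
open import Function.Bundles using (Inverse)
open import Function.Definitions using (Injective)
open import Level using (Level; _⊔_)
open import Relation.Binary.Consequences using (dec⇒weaklyDec)
open import Relation.Binary.Definitions using (Decidable)
open import Relation.Binary.PropositionalEquality as ≡ using (_≡_)
import Relation.Binary.Reasoning.Setoid as ≈-Reasoning
open import Relation.Nullary.Decidable using (Dec; yes; no; map′; ¬?; decidable-stable; _×-dec_)
open import Relation.Nullary.Negation using (¬_; contradiction)
open import Relation.Unary using (Pred; _∈_; _⊆_; _≐_)
open import Defs

-- In both families `δ ≠ 0` comes down to 5 being odd. For (C4), `δ = 0` forces `σ² a = a`, hence
-- `σ a = a` and `k = 1`. For (C3), it forces `σ η = - η`, and the five alternating conjugates sum
-- to `Tr η = η`, against `Tr η = 0` and `η ≠ 0`. The complement helps in (C3) because `U₃` is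
-- parametrised by an `x` that is neither of its coordinates, whereas its complement is cut out of
-- the pairs `(a , h)` with `h` in `𝔽q` by a single trace condition. That is the shape of the
-- target, up to one matrix. The field is known only through its order. Its characteristic, the
-- identity `x ^ (q ^ 5) = x` and Hilbert's theorem 90 are therefore derived by permuting all
-- elements or by counting roots, and the comparison of a map with its adjoint uses pigeonhole
-- instead of ranks. An element of nonzero trace is supplied by `ρ`.

module IntegerCoefficients {c ℓ : Level} (R : CommutativeRing c ℓ) where
  open CommutativeRing R
  open RingProperties ring
  open SemiringMult semiring renaming (_×_ to _•_)
  open ≈-Reasoning setoid

  ⟦_⟧ : ℤ → Carrier
  ⟦ + n ⟧      = n • 1#
  ⟦ -[1+ n ] ⟧ = - (suc n • 1#)

  ⟦⊖⟧ : ∀ m n → ⟦ m ℤ.⊖ n ⟧ ≈ m • 1# - n • 1#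
  ⟦⊖⟧ m       zero    = sym (trans (+-congˡ -0#≈0#) (+-identityʳ _))
  ⟦⊖⟧ zero    (suc n) = sym (+-identityˡ _)
  ⟦⊖⟧ (suc m) (suc n) = begin
    ⟦ suc m ℤ.⊖ suc n ⟧                    ≡⟨ ≡.cong ⟦_⟧ (ℤ.[1+m]⊖[1+n]≡m⊖n m n) ⟩
    ⟦ m ℤ.⊖ n ⟧                            ≈⟨ ⟦⊖⟧ m n ⟩
    m • 1# - n • 1#                        ≈⟨ xyx⁻¹≈y 1# _ ⟨
    1# + (m • 1# - n • 1#) - 1#            ≈⟨ +-congʳ (+-assoc 1# _ _) ⟨
    1# + m • 1# - n • 1# - 1#              ≈⟨ +-assoc _ _ _ ⟩
    1# + m • 1# + (- (n • 1#) - 1#)        ≈⟨ +-congˡ (-‿anti-homo-+ 1# (n • 1#)) ⟨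
    1# + m • 1# - (1# + n • 1#)            ∎

  ⟦-⟧ : ∀ i → ⟦ ℤ.- i ⟧ ≈ - ⟦ i ⟧
  ⟦-⟧ (+ zero)   = sym -0#≈0#
  ⟦-⟧ (+ suc n)  = refl
  ⟦-⟧ -[1+ n ]   = sym (-‿involutive _)

  ⟦+⟧ : ∀ i j → ⟦ i ℤ.+ j ⟧ ≈ ⟦ i ⟧ + ⟦ j ⟧
  ⟦+⟧ (+ m)    (+ n)    = ×-homo-+ 1# m n
  ⟦+⟧ (+ m)    -[1+ n ] = ⟦⊖⟧ m (suc n)
  ⟦+⟧ -[1+ m ] (+ n)    = trans (⟦⊖⟧ n (suc m)) (+-comm _ _)
  ⟦+⟧ -[1+ m ] -[1+ n ] = begin
    - (suc (suc (m ℕ.+ n)) • 1#)          ≡⟨ ≡.cong (λ k → - (suc k • 1#)) (ℕ.+-suc m n) ⟨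
    - ((suc m ℕ.+ suc n) • 1#)            ≈⟨ -‿cong (×-homo-+ 1# (suc m) (suc n)) ⟩
    - (suc m • 1# + suc n • 1#)           ≈⟨ -‿+-comm _ _ ⟨
    - (suc m • 1#) + - (suc n • 1#)       ∎

  ⟦+*⟧ : ∀ m j → ⟦ + m ℤ.* j ⟧ ≈ m • 1# * ⟦ j ⟧
  ⟦+*⟧ zero    j = trans (reflexive (≡.cong ⟦_⟧ (ℤ.*-zeroˡ j))) (sym (zeroˡ _))
  ⟦+*⟧ (suc m) j = begin
    ⟦ + suc m ℤ.* j ⟧                 ≡⟨ ≡.cong ⟦_⟧ (ℤ.suc-* (+ m) j) ⟩
    ⟦ j ℤ.+ + m ℤ.* j ⟧               ≈⟨ ⟦+⟧ j (+ m ℤ.* j) ⟩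
    ⟦ j ⟧ + ⟦ + m ℤ.* j ⟧             ≈⟨ +-cong (sym (*-identityˡ _)) (⟦+*⟧ m j) ⟩
    1# * ⟦ j ⟧ + m • 1# * ⟦ j ⟧       ≈⟨ distribʳ _ _ _ ⟨
    (1# + m • 1#) * ⟦ j ⟧             ∎

  ⟦*⟧ : ∀ i j → ⟦ i ℤ.* j ⟧ ≈ ⟦ i ⟧ * ⟦ j ⟧
  ⟦*⟧ (+ m)    j = ⟦+*⟧ m j
  ⟦*⟧ -[1+ m ] j = begin
    ⟦ -[1+ m ] ℤ.* j ⟧            ≡⟨ ≡.cong ⟦_⟧ (ℤ.neg-distribˡ-* (+ suc m) j) ⟨
    ⟦ ℤ.- (+ suc m ℤ.* j) ⟧       ≈⟨ ⟦-⟧ (+ suc m ℤ.* j) ⟩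
    - ⟦ + suc m ℤ.* j ⟧           ≈⟨ -‿cong (⟦+*⟧ (suc m) j) ⟩
    - (suc m • 1# * ⟦ j ⟧)        ≈⟨ -‿distribˡ-* _ _ ⟩
    - (suc m • 1#) * ⟦ j ⟧        ∎

  morphism : ℤ.+-*-rawRing -Raw-AlmostCommutative⟶ fromCommutativeRing R
  morphism = record
    { ⟦_⟧    = ⟦_⟧
    ; +-homo = ⟦+⟧
    ; *-homo = ⟦*⟧
    ; -‿homo = ⟦-⟧
    ; 0-homo = refl
    ; 1-homo = +-identityʳ 1#
    }

  -- Only positive answers carry information: distinct integers may have equal images, for instance
  -- when they agree modulo the characteristic.
  coefficient≟ : ∀ i j → Maybe (⟦ i ⟧ ≈ ⟦ j ⟧)
  coefficient≟ i j = Maybe.map (λ i≡j → reflexive (≡.cong ⟦_⟧ i≡j)) (dec⇒weaklyDec ℤ._≟_ i j)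

  open RingSolver ℤ.+-*-rawRing (fromCommutativeRing R) morphism coefficient≟ public
    using (solve; _:=_; _:+_; _:*_; _:-_; :-_; con)

-- Binomial coefficients at a prime and additivity of the Frobenius map.

prime∣pCk : ∀ {p} → Prime p → ∀ {k} → 0 ℕ.< k → k ℕ.< p → p ∣ p C k
-- The prime divides `p !`, which is the binomial coefficient times `k !` times `(p - k) !`. Both
-- factorials are products of positive numbers below `p`, so Euclid's lemma leaves only the
-- coefficient.
prime∣pCk {p} p-prime {k} 0<k k<p = go (euclidsLemma (p C k) (k ℕ.! ℕ.* (p ℕ.∸ k) ℕ.!) p-prime p∣product)
  where
  instance
    _ = prime⇒nonZero p-prime
    _ = k ℕ.!* (p ℕ.∸ k) !≢0
  ∤! : ∀ n → n ℕ.< p → ¬ p ∣ n ℕ.!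
  ∤! zero    _   p∣1  = >⇒∤ (ℕ.nonTrivial⇒n>1 p {{prime⇒nonTrivial p-prime}}) p∣1
  ∤! (suc n) n<p p∣n! with euclidsLemma (suc n) (n ℕ.!) p-prime p∣n!
  ... | inj₁ p∣1+n = >⇒∤ n<p p∣1+n
  ... | inj₂ p∣n!′ = ∤! n (ℕ.<⇒≤ n<p) p∣n!′
  p∣p! : ∀ n → .{{NonZero n}} → n ∣ n ℕ.!
  p∣p! (suc n) = m∣m*n (n ℕ.!)
  p∣product : p ∣ (p C k) ℕ.* (k ℕ.! ℕ.* (p ℕ.∸ k) ℕ.!)
  p∣product = ≡.subst (p ∣_) (≡.sym (≡.trans
    (≡.cong (ℕ._* (k ℕ.! ℕ.* (p ℕ.∸ k) ℕ.!)) (nCk≡n!/k![n-k]! (ℕ.<⇒≤ k<p)))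
    (m/n*n≡m (k![n∸k]!∣n! (ℕ.<⇒≤ k<p))))) (p∣p! p)
  go : p ∣ p C k ⊎ p ∣ k ℕ.! ℕ.* (p ℕ.∸ k) ℕ.! → p ∣ p C k
  go (inj₁ p∣pCk) = p∣pCk
  go (inj₂ p∣den) with euclidsLemma (k ℕ.!) ((p ℕ.∸ k) ℕ.!) p-prime p∣den
  ... | inj₁ p∣k!     = contradiction p∣k! (∤! k k<p)
  ... | inj₂ p∣[p-k]! = contradiction p∣[p-k]! (∤! (p ℕ.∸ k) (ℕ.∸-monoʳ-< 0<k (ℕ.<⇒≤ k<p)))

module Characteristic {c ℓ : Level} (R : CommutativeRing c ℓ) where
  open CommutativeRing R hiding (zero)
  open CommutativeExp commutativeSemiring
  open SemiringMult semiring renaming (_×_ to _•_)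
  open MonoidSum +-commutativeMonoid using (sum; sum-cong-≋; sum-init-last; sum-replicate-zero)
  open ≈-Reasoning setoid

  -- By `prime∣pCk` only the two extreme binomial terms survive. Index `k` carries
  -- `x ^ k * y ^ (p ∸ k)`, so the first of them is `y ^ p`.
  frobenius-+ : ∀ {p} → Prime p → p • 1# ≈ 0# → ∀ x y → (x + y) ^ p ≈ x ^ p + y ^ p
  frobenius-+ {zero}  () _ _ _
  frobenius-+ {p@(suc m)} p-prime p≈0 x y = begin
    (x + y) ^ p                                ≈⟨ Binomial.theorem commutativeSemiring p x y ⟩
    term zero + sum (term ∘ suc)               ≈⟨ +-congˡ (sum-init-last (term ∘ suc)) ⟩
    term zero + (sum middle + term (fromℕ p))  ≈⟨ +-congˡ (+-congʳ (trans (sum-cong-≋ middle≈0) (sum-replicate-zero m))) ⟩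
    term zero + (0# + term (fromℕ p))          ≈⟨ +-congˡ (+-identityˡ _) ⟩
    term zero + term (fromℕ p)                 ≈⟨ +-cong first≈y^p last≈x^p ⟩
    y ^ p + x ^ p                              ≈⟨ +-comm _ _ ⟩
    x ^ p + y ^ p                              ∎
    where
    term : Fin (suc p) → Carrier
    term = Binomial.binomialTerm commutativeSemiring x y p
    middle : Fin m → Carrier
    middle i = term (suc (inject₁ i))
    p∣⇒≈0 : ∀ {k} → p ∣ k → ∀ z → k • z ≈ 0#
    p∣⇒≈0 (divides j ≡.refl) z = begin
      (j ℕ.* p) • z         ≈⟨ ×-assocˡ z j p ⟨
      j • (p • z)           ≈⟨ ×-congʳ j (×-congʳ p (*-identityˡ z)) ⟨
      j • (p • (1# * z))    ≈⟨ ×-congʳ j (×-assoc-* p 1# z) ⟨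
      j • (p • 1# * z)      ≈⟨ ×-congʳ j (trans (*-congʳ p≈0) (zeroˡ z)) ⟩
      j • 0#                ≈⟨ ×-congʳ j (zeroˡ 0#) ⟨
      j • (0# * 0#)         ≈⟨ ×-comm-* j 0# 0# ⟨
      0# * (j • 0#)         ≈⟨ zeroˡ _ ⟩
      0#                    ∎
    middle≈0 : ∀ i → middle i ≈ 0#
    middle≈0 i = p∣⇒≈0 (prime∣pCk p-prime z<s (s<s (≡.subst (ℕ._< m) (≡.sym (toℕ-inject₁ i)) (toℕ<n i)))) _
    first≈y^p : term zero ≈ y ^ p
    first≈y^p = trans (×-homo-1 _) (*-identityˡ _)
    last≈x^p : term (fromℕ p) ≈ x ^ p
    last≈x^p = begin
      term (fromℕ p)                          ≡⟨ ≡.cong (λ k → (p C k) • (x ^ k * y ^ (p ℕ.∸ k))) (toℕ-fromℕ p) ⟩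
      (p C p) • (x ^ p * y ^ (p ℕ.∸ p))       ≡⟨ ≡.cong₂ (λ a b → a • (x ^ p * y ^ b)) (nCn≡1 p) (ℕ.n∸n≡0 p) ⟩
      1 • (x ^ p * 1#)                        ≈⟨ trans (×-homo-1 _) (*-identityʳ _) ⟩
      x ^ p                                   ∎

  frobenius-power-+ : ∀ {p} → Prime p → p • 1# ≈ 0# → ∀ e x y →
    (x + y) ^ (p ℕ.^ e) ≈ x ^ (p ℕ.^ e) + y ^ (p ℕ.^ e)
  frobenius-power-+ _ _ zero x y =
    trans (*-identityʳ _) (+-cong (sym (*-identityʳ x)) (sym (*-identityʳ y)))
  frobenius-power-+ {p} p-prime p≈0 (suc e) x y = begin
    (x + y) ^ (p ℕ.* p ℕ.^ e)                          ≈⟨ ^-assocʳ (x + y) p (p ℕ.^ e) ⟨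
    ((x + y) ^ p) ^ (p ℕ.^ e)                          ≈⟨ ^-congˡ (p ℕ.^ e) (frobenius-+ p-prime p≈0 x y) ⟩
    (x ^ p + y ^ p) ^ (p ℕ.^ e)                        ≈⟨ frobenius-power-+ p-prime p≈0 e (x ^ p) (y ^ p) ⟩
    (x ^ p) ^ (p ℕ.^ e) + (y ^ p) ^ (p ℕ.^ e)          ≈⟨ +-cong (^-assocʳ x p (p ℕ.^ e)) (^-assocʳ y p (p ℕ.^ e)) ⟩
    x ^ (p ℕ.* p ℕ.^ e) + y ^ (p ℕ.* p ℕ.^ e)          ∎

-- If `y` were missed, punching it out of the codomain would inject `Fin (suc n)` into `Fin n`.
injective⇒surjective : ∀ {n} {f : Fin n → Fin n} → Injective _≡_ _≡_ f → ∀ y → ∃ λ x → f x ≡ y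
injective⇒surjective {suc n} {f} f-injective y with any? (λ x → f x Fin.≟ y)
... | yes hit  = hit
... | no  miss = ⊥-elim (<⇒notInjective {f = λ x → punchOut (avoids x)} (ℕ.n<1+n n)
  (λ eq → f-injective (punchOut-injective (avoids _) (avoids _) eq)))
  where
  avoids : ∀ x → ¬ y ≡ f x
  avoids x y≡fx = miss (x , ≡.sym y≡fx)

-- Finite fields: characteristic, Fermat's identity, roots of polynomials.

module FiniteFieldProperties {c ℓ : Level} {n : ℕ} (K : FiniteField c ℓ n) where
  open FiniteField K hiding (zero)
  open RingProperties ring
  open CommutativeExp commutativeSemiring
  open SemiringMult semiring renaming (_×_ to _•_)
  open IntegerCoefficients commutativeRing using (solve; _:=_; _:+_; _:*_; _:-_; con)
  open Inverse enumeration using (to; from; to-cong; from-cong; strictlyInverseˡ; strictlyInverseʳ)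
  open ≈-Reasoning setoid

  private
    module Sum     = MonoidSum +-commutativeMonoid
    module Product = MonoidSum *-commutativeMonoid

  to-injective : ∀ {x y} → to x ≡ to y → x ≈ y
  to-injective {x} {y} eq = begin
    x           ≈⟨ strictlyInverseʳ x ⟨
    from (to x) ≈⟨ from-cong eq ⟩
    from (to y) ≈⟨ strictlyInverseʳ y ⟩
    y           ∎

  from-injective : ∀ {i j} → from i ≈ from j → i ≡ j
  from-injective {i} {j} eq =
    ≡.trans (≡.sym (strictlyInverseˡ i)) (≡.trans (to-cong eq) (strictlyInverseˡ j))

  infix 4 _≟_
  _≟_ : Decidable _≈_
  x ≟ y = map′ to-injective to-cong (to x Fin.≟ to y)

  ∃? : ∀ {p} {P : Carrier → Set p} → (∀ {x y} → x ≈ y → P x → P y) → (∀ x → Dec (P x)) → Dec (∃ P)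
  ∃? resp P? = map′ (λ (i , p) → from i , p) (λ (x , p) → to x , resp (sym (strictlyInverseʳ x)) p)
    (any? (λ i → P? (from i)))

  x≉0∧xy≈0⇒y≈0 : ∀ {x y} → ¬ x ≈ 0# → x * y ≈ 0# → y ≈ 0#
  x≉0∧xy≈0⇒y≈0 {x} {y} x≉0 xy≈0 = let (z , xz≈1) = inverse x x≉0 in begin
    y             ≈⟨ *-identityˡ y ⟨
    1# * y        ≈⟨ *-congʳ xz≈1 ⟨
    x * z * y     ≈⟨ solve 3 (λ x z y → x :* z :* y := z :* (x :* y)) refl x z y ⟩
    z * (x * y)   ≈⟨ *-congˡ xy≈0 ⟩
    z * 0#        ≈⟨ zeroʳ z ⟩
    0#            ∎

  *-nonzero : ∀ {x y} → ¬ x ≈ 0# → ¬ y ≈ 0# → ¬ x * y ≈ 0#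
  *-nonzero x≉0 y≉0 xy≈0 = y≉0 (x≉0∧xy≈0⇒y≈0 x≉0 xy≈0)

  *-cancelˡ : ∀ {x y z} → ¬ x ≈ 0# → x * y ≈ x * z → y ≈ z
  *-cancelˡ {x} {y} {z} x≉0 xy≈xz = x∙y⁻¹≈ε⇒x≈y y z (x≉0∧xy≈0⇒y≈0 x≉0
    (trans (x[y-z]≈xy-xz x y z) (x≈y⇒x∙y⁻¹≈ε xy≈xz)))

  inverse-nonzero : ∀ {x y} → x * y ≈ 1# → ¬ y ≈ 0#
  inverse-nonzero {x} xy≈1 y≈0 = 1≉0 (trans (sym xy≈1) (trans (*-congˡ y≈0) (zeroʳ x)))

  ^-nonzero : ∀ {x} m → ¬ x ≈ 0# → ¬ x ^ m ≈ 0#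
  ^-nonzero zero    x≉0 = 1≉0
  ^-nonzero (suc m) x≉0 = *-nonzero x≉0 (^-nonzero m x≉0)

  module _ {a b : Level} (M : CommutativeMonoid a b) where
    private module M = CommutativeMonoid M
    open MonoidSum M using (sum; sum-cong-≋; sum-permute)

    -- Stated over an arbitrary commutative monoid so that it serves sums (translation by 1) and
    -- products (multiplication by a unit) alike.
    sum-reindex : (h : Carrier → M.Carrier) → (∀ {x y} → x ≈ y → h x M.≈ h y) →
      (f g : Carrier → Carrier) → (∀ {x y} → x ≈ y → f x ≈ f y) → (∀ {x y} → x ≈ y → g x ≈ g y) →
      (∀ x → f (g x) ≈ x) → (∀ x → g (f x) ≈ x) →
      sum (λ i → h (from i)) M.≈ sum (λ i → h (f (from i)))
    sum-reindex h h-cong f g f-cong g-cong fg gf = M.trans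
      (sum-permute (λ i → h (from i)) π)
      (sum-cong-≋ (λ i → h-cong (strictlyInverseʳ (f (from i)))))
      where
      π : Permutation′ n
      π = permutation (λ i → to (f (from i))) (λ i → to (g (from i)))
        (λ i → ≡.trans (to-cong (trans (f-cong (strictlyInverseʳ _)) (fg _))) (strictlyInverseˡ i))
        (λ i → ≡.trans (to-cong (trans (g-cong (strictlyInverseʳ _)) (gf _))) (strictlyInverseˡ i))

  -- Translating by 1 permutes the field, so adding n·1 to the sum of all elements does not change it.
  n•1≈0 : n • 1# ≈ 0#
  n•1≈0 = +-identityʳ-unique S (n • 1#) (begin
    S + n • 1#                             ≈⟨ +-congˡ (Sum.sum-replicate n) ⟨
    S + Sum.sum {n} (λ _ → 1#)             ≈⟨ Sum.∑-distrib-+ from (λ _ → 1#) ⟨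
    Sum.sum (λ i → from i + 1#)            ≈⟨ sum-reindex +-commutativeMonoid (λ x → x) (λ eq → eq) (_+ 1#) (_- 1#) +-congʳ +-congʳ
                                                (λ x → solve 2 (λ x y → x :- y :+ y := x) refl x 1#)
                                                (λ x → solve 2 (λ x y → x :+ y :- y := x) refl x 1#) ⟨
    S                                      ∎)
    where S = Sum.sum from

  -- Here `(p • 1#) ^ m` equals `n • 1#`, which is zero, and a field has no nonzero nilpotents.
  characteristic : ∀ p m → n ≡ p ℕ.^ m → p • 1# ≈ 0#
  characteristic p m n≡p^m with p • 1# ≟ 0#
  ... | yes p≈0 = p≈0
  ... | no  p≉0 = contradiction (trans (sym (power m)) (trans (×-congˡ (≡.sym n≡p^m)) n•1≈0)) (^-nonzero m p≉0)
    where
    power : ∀ m → (p ℕ.^ m) • 1# ≈ (p • 1#) ^ m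
    power zero    = +-identityʳ 1#
    power (suc m) = trans (×1-homo-* p (p ℕ.^ m)) (*-congˡ (power m))

  -- The element of `Fin m` is evidence that `m` is positive; the zeroth power of 0 would be 1.
  0^m≈0 : ∀ {m} → Fin m → 0# ^ m ≈ 0#
  0^m≈0 {suc m} _ = zeroˡ _

  -- The slot `i` is that of the zero element, whose factor was replaced by 1; the extra `x` in
  -- front makes up for it.
  x*∏≈x^m : ∀ {m} x (t : Fin m → Carrier) i → t i ≈ 1# → (∀ j → ¬ j ≡ i → t j ≈ x) →
    x * Product.sum t ≈ x ^ m
  x*∏≈x^m {suc m} x t i tᵢ≈1 tⱼ≈x = *-congˡ (begin
    Product.sum t                                   ≈⟨ Product.sum-remove t ⟩
    t i * Product.sum (λ j → t (punchIn i j))       ≈⟨ *-cong tᵢ≈1 (Product.sum-cong-≋ (λ j → tⱼ≈x _ (punchInᵢ≢i i j))) ⟩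
    1# * Product.sum {m} (λ _ → x)                  ≈⟨ *-identityˡ _ ⟩
    Product.sum {m} (λ _ → x)                       ≈⟨ Product.sum-replicate m ⟩
    x ^ m                                           ∎)

  -- As in Fermat's little theorem, multiplication by x permutes the nonzero elements; in the products
  -- over all elements the factor 0 is replaced by 1.
  x^n≈x : ∀ x → x ^ n ≈ x
  x^n≈x x with x ≟ 0#
  ... | yes x≈0 = trans (^-congˡ n x≈0) (trans (0^m≈0 (to 0#)) (sym x≈0))
  ... | no  x≉0 = begin
    x ^ n                              ≈⟨ x*∏≈x^m x (λ i → factor (from i)) (to 0#) (factor-0 (strictlyInverseʳ 0#))
                                            (λ j j≢0 → factor-x (λ fj≈0 → j≢0 (≡.trans (≡.sym (strictlyInverseˡ j)) (to-cong fj≈0)))) ⟨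
    x * F                              ≈⟨ *-congˡ (*-cancelˡ P≉0 (begin
      P * F                                                                   ≈⟨ *-comm P F ⟩
      F * P                                                                   ≈⟨ Product.∑-distrib-+ (λ i → factor (from i)) (λ i → unit (from i)) ⟨
      Product.sum (λ i → factor (from i) * unit (from i))                     ≈⟨ Product.sum-cong-≋ (λ i → unit-x* (from i)) ⟨
      Product.sum (λ i → unit (x * from i))                                   ≈⟨ sum-reindex *-commutativeMonoid unit unit-cong (x *_) (y *_) *-congˡ *-congˡ
                                                                                   (λ z → trans (sym (*-assoc x y z)) (trans (*-congʳ xy≈1) (*-identityˡ z)))
                                                                                   (λ z → trans (sym (*-assoc y x z)) (trans (*-congʳ (trans (*-comm y x) xy≈1)) (*-identityˡ z))) ⟨
      P                                                                       ≈⟨ *-identityʳ P ⟨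
      P * 1#                                                                  ∎)) ⟩
    x * 1#                             ≈⟨ *-identityʳ x ⟩
    x                                  ∎
    where
    y    = proj₁ (inverse x x≉0)
    xy≈1 = proj₂ (inverse x x≉0)
    unit factor : Carrier → Carrier
    unit z with z ≟ 0#
    ... | yes _ = 1#
    ... | no  _ = z
    factor z with z ≟ 0#
    ... | yes _ = 1#
    ... | no  _ = x
    F = Product.sum (λ i → factor (from i))
    P = Product.sum (λ i → unit (from i))
    factor-0 : ∀ {z} → z ≈ 0# → factor z ≈ 1#
    factor-0 {z} z≈0 with z ≟ 0#
    ... | yes _   = refl
    ... | no  z≉0 = contradiction z≈0 z≉0
    factor-x : ∀ {z} → ¬ z ≈ 0# → factor z ≈ x
    factor-x {z} z≉0 with z ≟ 0#
    ... | yes z≈0 = contradiction z≈0 z≉0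
    ... | no  _   = refl
    unit-cong : ∀ {u v} → u ≈ v → unit u ≈ unit v
    unit-cong {u} {v} u≈v with u ≟ 0# | v ≟ 0#
    ... | yes _   | yes _   = refl
    ... | yes u≈0 | no  v≉0 = contradiction (trans (sym u≈v) u≈0) v≉0
    ... | no  u≉0 | yes v≈0 = contradiction (trans u≈v v≈0) u≉0
    ... | no  _   | no  _   = u≈v
    unit-nonzero : ∀ z → ¬ unit z ≈ 0#
    unit-nonzero z with z ≟ 0#
    ... | yes _   = 1≉0
    ... | no  z≉0 = z≉0
    unit-x* : ∀ z → unit (x * z) ≈ factor z * unit z
    unit-x* z with z ≟ 0# | x * z ≟ 0#
    ... | yes _   | yes _    = sym (*-identityˡ 1#)
    ... | yes z≈0 | no  xz≉0 = contradiction (trans (*-congˡ z≈0) (zeroʳ x)) xz≉0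
    ... | no  z≉0 | yes xz≈0 = contradiction xz≈0 (*-nonzero x≉0 z≉0)
    ... | no  _   | no  _    = refl
    ∏-nonzero : ∀ {m} (t : Fin m → Carrier) → (∀ i → ¬ t i ≈ 0#) → ¬ Product.sum t ≈ 0#
    ∏-nonzero {zero}  t t≉0 = 1≉0
    ∏-nonzero {suc m} t t≉0 = *-nonzero (t≉0 zero) (∏-nonzero (t ∘ suc) (t≉0 ∘ suc))
    P≉0 : ¬ P ≈ 0#
    P≉0 = ∏-nonzero (λ i → unit (from i)) (λ i → unit-nonzero (from i))

  endomap-surjective : (f : Carrier → Carrier) → (∀ {x y} → x ≈ y → f x ≈ f y) →
    (∀ {x y} → f x ≈ f y → x ≈ y) → ∀ y → ∃ λ x → f x ≈ y
  endomap-surjective f f-cong f-injective y =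
    let (i , eq) = injective⇒surjective {f = λ i → to (f (from i))}
                     (λ eq → from-injective (f-injective (to-injective eq))) (to y)
    in from i , to-injective eq

  -- Polynomial functions of formal degree d with coefficient a (possibly zero) of x ^ d, in Horner form.
  Polynomial : ℕ → Carrier → (Carrier → Carrier) → Set (c ⊔ ℓ)
  Polynomial zero    a f = Level.Lift c (∀ x → f x ≈ a)
  Polynomial (suc d) a f = ∃₂ λ b g → Polynomial d a g × (∀ x → f x ≈ b + x * g x)

  polynomial-+ : ∀ d {a b f g} → Polynomial d a f → Polynomial d b g → Polynomial d (a + b) (λ x → f x + g x)
  polynomial-+ zero    (Level.lift f≈a) (Level.lift g≈b) = Level.lift (λ x → +-cong (f≈a x) (g≈b x))
  polynomial-+ (suc d) (a₀ , f′ , f′-poly , f≈) (b₀ , g′ , g′-poly , g≈) =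
    a₀ + b₀ , (λ x → f′ x + g′ x) , polynomial-+ d f′-poly g′-poly , λ x → trans (+-cong (f≈ x) (g≈ x))
      (solve 5 (λ a b x f g → (a :+ x :* f) :+ (b :+ x :* g) := (a :+ b) :+ x :* (f :+ g)) refl a₀ b₀ x (f′ x) (g′ x))

  polynomial-monomial : ∀ d a → Polynomial d a (λ x → a * x ^ d)
  polynomial-monomial zero    a = Level.lift (λ x → *-identityʳ a)
  polynomial-monomial (suc d) a = 0# , (λ x → a * x ^ d) , polynomial-monomial d a ,
    λ x → solve 3 (λ a x y → a :* (x :* y) := con (+ 0) :+ x :* (a :* y)) refl a x (x ^ d)

  -- Since `polynomial-+` adds only polynomials of equal formal degree, lower terms are padded with
  -- a leading coefficient 0.
  polynomial-raise : ∀ {d e a f} → d ℕ.< e → Polynomial d a f → Polynomial e 0# f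
  polynomial-raise {zero} {suc e} {a} _ (Level.lift f≈a) =
    a , (λ x → 0# * x ^ e) , polynomial-monomial e 0# ,
    λ x → trans (f≈a x) (solve 3 (λ a x y → a := a :+ x :* (con (+ 0) :* y)) refl a x (x ^ e))
  polynomial-raise {suc d} {suc e} (s<s d<e) (b , g , g-poly , f≈) = b , g , polynomial-raise d<e g-poly , f≈

  -- Synthetic division: if `f = b + x g` and `g` has quotient `s` by `x - r`, then `f` has quotient
  -- `g r + x s`. The leading coefficient `a` is kept, which is what the induction in `root-bound`
  -- needs.
  factor-theorem : ∀ d {a f} → Polynomial (suc d) a f → ∀ r →
    ∃ λ g → Polynomial d a g × (∀ x → f x ≈ f r + (x - r) * g x)
  factor-theorem zero {a} {f} (b , g , Level.lift g≈a , f≈) r =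
    (λ _ → a) , Level.lift (λ _ → refl) , λ x → begin
      f x                          ≈⟨ trans (f≈ x) (+-congˡ (*-congˡ (g≈a x))) ⟩
      b + x * a                    ≈⟨ solve 4 (λ b x a r → b :+ x :* a := b :+ r :* a :+ (x :- r) :* a) refl b x a r ⟩
      b + r * a + (x - r) * a      ≈⟨ +-congʳ (trans (f≈ r) (+-congˡ (*-congˡ (g≈a r)))) ⟨
      f r + (x - r) * a            ∎
  factor-theorem (suc d) {a} {f} (b , g , g-poly , f≈) r =
    let (s , s-poly , g≈) = factor-theorem d g-poly r
    in (λ x → g r + x * s x) , (g r , s , s-poly , λ _ → refl) , λ x → begin
      f x                                             ≈⟨ trans (f≈ x) (+-congˡ (*-congˡ (g≈ x))) ⟩
      b + x * (g r + (x - r) * s x)                   ≈⟨ solve 5 (λ b x r gr sx → b :+ x :* (gr :+ (x :- r) :* sx)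
                                                           := b :+ r :* gr :+ (x :- r) :* (gr :+ x :* sx)) refl b x r (g r) (s x) ⟩
      b + r * g r + (x - r) * (g r + x * s x)         ≈⟨ +-congʳ (f≈ r) ⟨
      f r + (x - r) * (g r + x * s x)                 ∎

  -- Splitting off the root `r zero` leaves a quotient with the same leading coefficient that
  -- vanishes at the other points; at degree 0 it is the nonzero constant `a`.
  root-bound : ∀ d {a f} → ¬ a ≈ 0# → Polynomial d a f →
    (r : Fin (suc d) → Carrier) → (∀ {i j} → r i ≈ r j → i ≡ j) → ¬ (∀ i → f (r i) ≈ 0#)
  root-bound zero    a≉0 (Level.lift f≈a) r r-injective roots = a≉0 (trans (sym (f≈a (r zero))) (roots zero))
  root-bound (suc d) {f = f} a≉0 f-poly r r-injective roots =
    let (g , g-poly , f≈) = factor-theorem d f-poly (r zero)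
    in root-bound d a≉0 g-poly (r ∘ suc) (λ eq → Fin.suc-injective (r-injective eq)) λ i →
      x≉0∧xy≈0⇒y≈0 (λ eq → contradiction (r-injective (x∙y⁻¹≈ε⇒x≈y _ _ eq)) λ ()) (begin
        (r (suc i) - r zero) * g (r (suc i))                 ≈⟨ +-identityˡ _ ⟨
        0# + (r (suc i) - r zero) * g (r (suc i))            ≈⟨ +-congʳ (roots zero) ⟨
        f (r zero) + (r (suc i) - r zero) * g (r (suc i))    ≈⟨ f≈ (r (suc i)) ⟨
        f (r (suc i))                                        ≈⟨ roots (suc i) ⟩
        0#                                                   ∎)

  nonroot : ∀ {d a f} → d ℕ.< n → ¬ a ≈ 0# → Polynomial d a f → ∃ λ x → ¬ f x ≈ 0#
  nonroot {d} {a} {f} d<n a≉0 f-poly with any? (λ i → ¬? (f (from i) ≟ 0#))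
  ... | yes (i , fi≉0) = from i , fi≉0
  ... | no  all-roots  = contradiction
    (λ i → decidable-stable (f (from (inject≤ i d<n)) ≟ 0#) (λ fi≉0 → all-roots (_ , fi≉0)))
    (root-bound d a≉0 f-poly (λ i → from (inject≤ i d<n))
      (λ eq → inject≤-injective d<n d<n _ _ (from-injective eq)))

module LinearSetProperties {c ℓ : Level} (q : ℕ) (q-primePower : IsPrimePower q) (F : FiniteField c ℓ (q ℕ.^ 5)) where
  open FiniteField F hiding (zero)
  open RingProperties ring
  open CommutativeExp commutativeSemiring
  open IntegerCoefficients commutativeRing using (solve; _:=_; _:+_; _:*_; _:-_; :-_; con)
  open FiniteFieldProperties F
  open LinearSets q F
  open PGL₂ using (applyᵥ; applyᵥ-nonzero)
  open ≈-Reasoning setoid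

  private
    p : ℕ
    p = proj₁ q-primePower
    e : ℕ
    e = proj₁ (proj₂ q-primePower)
    p-prime : Prime p
    p-prime = proj₁ (proj₂ (proj₂ q-primePower))
    q≡p^ : q ≡ p ℕ.^ suc e
    q≡p^ = proj₂ (proj₂ (proj₂ q-primePower))

  1<q : 1 ℕ.< q
  1<q = ≡.subst (1 ℕ.<_) (≡.sym q≡p^)
    (ℕ.^-monoʳ-< p (ℕ.nonTrivial⇒n>1 p {{prime⇒nonTrivial p-prime}}) {0} {suc e} z<s)

  record Additive (f : Carrier → Carrier) : Set (c ⊔ ℓ) where
    field
      f-cong : ∀ {x y} → x ≈ y → f x ≈ f y
      f-+    : ∀ x y → f (x + y) ≈ f x + f y

    f-0 : f 0# ≈ 0#
    f-0 = x+x≈x⇒x≈0 (f 0#) (trans (sym (f-+ 0# 0#)) (f-cong (+-identityʳ 0#)))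

    f-neg : ∀ x → f (- x) ≈ - f x
    f-neg x = +-inverseˡ-unique (f (- x)) (f x)
      (trans (sym (f-+ (- x) x)) (trans (f-cong (-‿inverseˡ x)) f-0))

    f-sub : ∀ x y → f (x - y) ≈ f x - f y
    f-sub x y = trans (f-+ x (- y)) (+-congˡ (f-neg y))

    f-injective : (∀ {x} → f x ≈ 0# → x ≈ 0#) → ∀ {x y} → f x ≈ f y → x ≈ y
    f-injective trivial {x} {y} fx≈fy =
      x∙y⁻¹≈ε⇒x≈y x y (trivial (trans (f-sub x y) (x≈y⇒x∙y⁻¹≈ε fx≈fy)))

  open Additive

  id-additive : Additive (λ x → x)
  id-additive = record { f-cong = λ eq → eq ; f-+ = λ _ _ → refl }

  scale-additive : ∀ a → Additive (a *_)
  scale-additive a = record { f-cong = *-congˡ ; f-+ = distribˡ a }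

  ∘-additive : ∀ {f g} → Additive f → Additive g → Additive (λ x → f (g x))
  ∘-additive f-add g-add = record
    { f-cong = λ eq → f-cong f-add (f-cong g-add eq)
    ; f-+    = λ x y → trans (f-cong f-add (f-+ g-add x y)) (f-+ f-add _ _)
    }

  +-additive : ∀ {f g} → Additive f → Additive g → Additive (λ x → f x + g x)
  +-additive {f} {g} f-add g-add = record
    { f-cong = λ eq → +-cong (f-cong f-add eq) (f-cong g-add eq)
    ; f-+    = λ x y → trans (+-cong (f-+ f-add x y) (f-+ g-add x y))
        (solve 4 (λ a b c d → a :+ b :+ (c :+ d) := a :+ c :+ (b :+ d)) refl (f x) (f y) (g x) (g y))
    }

  neg-additive : ∀ {f} → Additive f → Additive (λ x → - f x)
  neg-additive f-add = record
    { f-cong = λ eq → -‿cong (f-cong f-add eq)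
    ; f-+    = λ x y → trans (-‿cong (f-+ f-add x y)) (sym (-‿+-comm _ _))
    }

  -- The Frobenius `σ` with `σ⁵ = 1`, the trace form, and Hilbert's theorem 90.

  σ σ² σ³ σ⁴ : Carrier → Carrier
  σ x  = x ^ q
  σ² x = σ (σ x)
  σ³ x = σ (σ² x)
  σ⁴ x = σ (σ³ x)

  σ-additive : Additive σ
  σ-additive = record
    { f-cong = ^-congˡ q
    ; f-+    = λ x y → ≡.subst (λ r → (x + y) ^ r ≈ x ^ r + y ^ r) (≡.sym q≡p^)
        (Characteristic.frobenius-power-+ commutativeRing p-prime
          (characteristic p (suc e ℕ.* 5) (≡.trans (≡.cong (ℕ._^ 5) q≡p^) (ℕ.^-*-assoc p (suc e) 5))) (suc e) x y)
    }

  σ²-additive : Additive σ²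
  σ²-additive = ∘-additive σ-additive σ-additive

  σ³-additive : Additive σ³
  σ³-additive = ∘-additive σ-additive σ²-additive

  σ⁴-additive : Additive σ⁴
  σ⁴-additive = ∘-additive σ-additive σ³-additive

  σ-cong : ∀ {x y} → x ≈ y → σ x ≈ σ y
  σ-cong = f-cong σ-additive

  σ-* : ∀ x y → σ (x * y) ≈ σ x * σ y
  σ-* x y = ^-distrib-* x y q

  σ-1 : σ 1# ≈ 1#
  σ-1 = go q
    where
    go : ∀ m → 1# ^ m ≈ 1#
    go zero    = refl
    go (suc m) = trans (*-identityˡ _) (go m)

  ^q^0 : ∀ x → x ^ (q ℕ.^ 0) ≈ x
  ^q^0 = *-identityʳ

  ^q^suc : ∀ x m → x ^ (q ℕ.^ suc m) ≈ σ x ^ (q ℕ.^ m)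
  ^q^suc x m = sym (^-assocʳ x q (q ℕ.^ m))

  ^q² : ∀ x → x ^ (q ℕ.^ 2) ≈ σ² x
  ^q² x = trans (^q^suc x 1) (trans (^q^suc (σ x) 0) (^q^0 _))

  ^q³ : ∀ x → x ^ (q ℕ.^ 3) ≈ σ³ x
  ^q³ x = trans (^q^suc x 2) (^q² (σ x))

  ^q⁴ : ∀ x → x ^ (q ℕ.^ 4) ≈ σ⁴ x
  ^q⁴ x = trans (^q^suc x 3) (^q³ (σ x))

  σ⁵ : ∀ x → σ (σ⁴ x) ≈ x
  σ⁵ x = trans (sym (trans (^q^suc x 4) (^q⁴ (σ x)))) (x^n≈x x)

  σ-nonzero : ∀ {x} → ¬ x ≈ 0# → ¬ σ x ≈ 0#
  σ-nonzero = ^-nonzero q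

  -- Exponents are coprime to 5: here `σ⁴ x = x`, so `x = σ (σ⁴ x) = σ x`. For `σ³` one uses that
  -- its square is `σ`.
  σ²-fixed : ∀ {x} → σ² x ≈ x → σ x ≈ x
  σ²-fixed {x} σ²x≈x = begin
    σ x            ≈⟨ σ-cong (trans (f-cong σ²-additive σ²x≈x) σ²x≈x) ⟨
    σ (σ⁴ x)       ≈⟨ σ⁵ x ⟩
    x              ∎

  σ³-fixed : ∀ {x} → σ³ x ≈ x → σ x ≈ x
  σ³-fixed {x} σ³x≈x = begin
    σ x            ≈⟨ σ⁵ (σ x) ⟨
    σ³ (σ³ x)      ≈⟨ f-cong σ³-additive σ³x≈x ⟩
    σ³ x           ≈⟨ σ³x≈x ⟩
    x              ∎

  σ⁴-fixed : ∀ {x} → σ⁴ x ≈ x → σ x ≈ x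
  σ⁴-fixed {x} σ⁴x≈x = trans (σ-cong (sym σ⁴x≈x)) (σ⁵ x)

  Tr-expand : ∀ x → Tr x ≈ x + σ x + σ² x + σ³ x + σ⁴ x
  Tr-expand x = +-cong (+-cong (+-congˡ (^q² x)) (^q³ x)) (^q⁴ x)

  Tr-additive : Additive Tr
  Tr-additive = record
    { f-cong = λ {x} {y} eq → trans (Tr-expand x) (trans (f-cong sum-additive eq) (sym (Tr-expand y)))
    ; f-+    = λ x y → trans (Tr-expand (x + y)) (trans (f-+ sum-additive x y)
        (+-cong (sym (Tr-expand x)) (sym (Tr-expand y))))
    }
    where
    sum-additive : Additive (λ x → x + σ x + σ² x + σ³ x + σ⁴ x)
    sum-additive = +-additive (+-additive (+-additive (+-additive id-additive σ-additive)
      σ²-additive) σ³-additive) σ⁴-additive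

  Tr-cong : ∀ {x y} → x ≈ y → Tr x ≈ Tr y
  Tr-cong = f-cong Tr-additive

  Tr-σ : ∀ x → Tr (σ x) ≈ Tr x
  Tr-σ x = begin
    Tr (σ x)                              ≈⟨ Tr-expand (σ x) ⟩
    σ x + σ² x + σ³ x + σ⁴ x + σ (σ⁴ x)   ≈⟨ +-congˡ (σ⁵ x) ⟩
    σ x + σ² x + σ³ x + σ⁴ x + x          ≈⟨ solve 5 (λ a b c d e → b :+ c :+ d :+ e :+ a := a :+ b :+ c :+ d :+ e)
                                               refl x (σ x) (σ² x) (σ³ x) (σ⁴ x) ⟩
    x + σ x + σ² x + σ³ x + σ⁴ x          ≈⟨ Tr-expand x ⟨
    Tr x                                  ∎

  σ-Tr : ∀ x → σ (Tr x) ≈ Tr x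
  σ-Tr x = begin
    σ (Tr x)                              ≈⟨ σ-cong (Tr-expand x) ⟩
    σ (x + σ x + σ² x + σ³ x + σ⁴ x)      ≈⟨ trans (f-+ σ-additive _ _) (+-congʳ (trans (f-+ σ-additive _ _)
                                               (+-congʳ (trans (f-+ σ-additive _ _) (+-congʳ (f-+ σ-additive _ _)))))) ⟩
    σ x + σ² x + σ³ x + σ⁴ x + σ (σ⁴ x)   ≈⟨ Tr-expand (σ x) ⟨
    Tr (σ x)                              ≈⟨ Tr-σ x ⟩
    Tr x                                  ∎

  Tr-scale : ∀ {h} → σ h ≈ h → ∀ x → Tr (h * x) ≈ h * Tr x
  Tr-scale {h} σh≈h x = begin
    Tr (h * x)                                                    ≈⟨ Tr-expand (h * x) ⟩
    h * x + σ (h * x) + σ² (h * x) + σ³ (h * x) + σ⁴ (h * x)      ≈⟨ +-cong (+-cong (+-cong (+-congˡ one) two) three) four ⟩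
    h * x + h * σ x + h * σ² x + h * σ³ x + h * σ⁴ x              ≈⟨ solve 6 (λ h a b c d e → h :* a :+ h :* b :+ h :* c :+ h :* d :+ h :* e
                                                                       := h :* (a :+ b :+ c :+ d :+ e)) refl h x (σ x) (σ² x) (σ³ x) (σ⁴ x) ⟩
    h * (x + σ x + σ² x + σ³ x + σ⁴ x)                            ≈⟨ *-congˡ (Tr-expand x) ⟨
    h * Tr x                                                      ∎
    where
    step : ∀ {y z} → y ≈ h * z → σ y ≈ h * σ z
    step {y} {z} y≈hz = trans (σ-cong y≈hz) (trans (σ-* h z) (*-congʳ σh≈h))
    one   = step refl
    two   = step one
    three = step two
    four  = step three

  -- The adjoint of `σ` for the trace form is its inverse `σ⁴`, because `Tr` is invariant under `σ`.
  Tr-shift : ∀ x y → Tr (x * σ y) ≈ Tr (σ⁴ x * y)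
  Tr-shift x y = begin
    Tr (x * σ y)            ≈⟨ Tr-cong (*-congʳ (σ⁵ x)) ⟨
    Tr (σ (σ⁴ x) * σ y)     ≈⟨ Tr-cong (σ-* (σ⁴ x) y) ⟨
    Tr (σ (σ⁴ x * y))       ≈⟨ Tr-σ _ ⟩
    Tr (σ⁴ x * y)           ∎

  Tr-shift⁴ : ∀ x y → Tr (x * σ⁴ y) ≈ Tr (σ x * y)
  Tr-shift⁴ x y = begin
    Tr (x * σ⁴ y)           ≈⟨ Tr-σ _ ⟨
    Tr (σ (x * σ⁴ y))       ≈⟨ Tr-cong (trans (σ-* x (σ⁴ y)) (*-congˡ (σ⁵ y))) ⟩
    Tr (σ x * y)            ∎

  N-expand : ∀ x → N x ≈ x * σ x * σ² x * σ³ x * σ⁴ x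
  N-expand x = begin
    x ^ (1 ℕ.+ q ℕ.+ q ℕ.^ 2 ℕ.+ q ℕ.^ 3 ℕ.+ q ℕ.^ 4)
      ≈⟨ trans (^-homo-* x (1 ℕ.+ q ℕ.+ q ℕ.^ 2 ℕ.+ q ℕ.^ 3) (q ℕ.^ 4)) (*-cong
           (trans (^-homo-* x (1 ℕ.+ q ℕ.+ q ℕ.^ 2) (q ℕ.^ 3)) (*-cong
             (^-homo-* x (1 ℕ.+ q) (q ℕ.^ 2)) (^q³ x))) (^q⁴ x)) ⟩
    x * σ x * x ^ (q ℕ.^ 2) * σ³ x * σ⁴ x      ≈⟨ *-congʳ (*-congʳ (*-congˡ (^q² x))) ⟩
    x * σ x * σ² x * σ³ x * σ⁴ x               ∎

  -- The witness is a value of the Lagrange resolvent `f`, whose coefficients are the partial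
  -- products of the conjugates of `k`. Applying `k * σ` shifts its summands cyclically, the norm
  -- condition closing the cycle. As a polynomial, `f` has degree `q ^ 4` with nonzero leading
  -- coefficient, so it cannot vanish on all `q ^ 5` elements.
  hilbert90 : ∀ {k} → N k ≈ 1# → ∃ λ z → ¬ z ≈ 0# × k * σ z ≈ z
  hilbert90 {k} Nk≈1 =
    let (x , fx≉0) = nonroot {f = f} (ℕ.^-monoʳ-< q 1<q (ℕ.n<1+n 4)) lead≉0 f-polynomial
    in f x , fx≉0 , (begin
      k * σ (f x)                  ≈⟨ *-congˡ (σ-cong (f-expand x)) ⟩
      k * σ (1# * x + k * σ x + a₂ * σ² x + a₃ * σ³ x + a₄ * σ⁴ x)
                                   ≈⟨ *-congˡ (trans (f-+ σ-additive _ _) (+-cong (trans (f-+ σ-additive _ _)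
                                        (+-cong (trans (f-+ σ-additive _ _) (+-cong (trans (f-+ σ-additive _ _)
                                        (+-cong (trans (σ-* _ _) (*-congʳ σ-1)) (σ-* _ _)))
                                        (trans (σ-* _ _) (*-congʳ (σ-* _ _)))))
                                        (trans (σ-* _ _) (*-congʳ (trans (σ-* _ _) (*-congʳ (σ-* _ _)))))))
                                        (trans (σ-* _ _) (*-cong (trans (σ-* _ _) (*-congʳ (trans (σ-* _ _) (*-congʳ (σ-* _ _))))) (σ⁵ x))))) ⟩
      k * (1# * σ x + k₁ * σ² x + k₁ * k₂ * σ³ x + k₁ * k₂ * k₃ * σ⁴ x + k₁ * k₂ * k₃ * k₄ * x)
                                   -- The last summand now carries all five conjugates of `k`; it
                                   -- moves to the front, to become `1# * x`.
                                   ≈⟨ solve 11 (λ k k₁ k₂ k₃ k₄ x x₁ x₂ x₃ x₄ o →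
                                        k :* (o :* x₁ :+ k₁ :* x₂ :+ k₁ :* k₂ :* x₃ :+ k₁ :* k₂ :* k₃ :* x₄ :+ k₁ :* k₂ :* k₃ :* k₄ :* x)
                                        := k :* k₁ :* k₂ :* k₃ :* k₄ :* x :+ k :* (o :* x₁) :+ k :* k₁ :* x₂ :+ k :* k₁ :* k₂ :* x₃ :+ k :* k₁ :* k₂ :* k₃ :* x₄)
                                        refl k k₁ k₂ k₃ k₄ x (σ x) (σ² x) (σ³ x) (σ⁴ x) 1# ⟩
      k * k₁ * k₂ * k₃ * k₄ * x + k * (1# * σ x) + a₂ * σ² x + a₃ * σ³ x + a₄ * σ⁴ x
                                   ≈⟨ +-congʳ (+-congʳ (+-congʳ (+-cong (*-congʳ norm≈1) (*-congˡ (*-identityˡ _))))) ⟩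
      1# * x + k * σ x + a₂ * σ² x + a₃ * σ³ x + a₄ * σ⁴ x
                                   ≈⟨ f-expand x ⟨
      f x                          ∎)
    where
    k₁ = σ k
    k₂ = σ² k
    k₃ = σ³ k
    k₄ = σ⁴ k
    a₂ = k * k₁
    a₃ = k * k₁ * k₂
    a₄ = k * k₁ * k₂ * k₃
    norm≈1 : k * k₁ * k₂ * k₃ * k₄ ≈ 1#
    norm≈1 = trans (sym (N-expand k)) Nk≈1
    k≉0 : ¬ k ≈ 0#
    k≉0 = inverse-nonzero (trans (solve 5 (λ a b c d e → b :* c :* d :* e :* a := a :* b :* c :* d :* e) refl k k₁ k₂ k₃ k₄) norm≈1)
    f : Carrier → Carrier
    f x = 1# * x ^ (q ℕ.^ 0) + k * x ^ (q ℕ.^ 1) + a₂ * x ^ (q ℕ.^ 2) + a₃ * x ^ (q ℕ.^ 3) + a₄ * x ^ (q ℕ.^ 4)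
    f-expand : ∀ x → f x ≈ 1# * x + k * σ x + a₂ * σ² x + a₃ * σ³ x + a₄ * σ⁴ x
    f-expand x = +-cong (+-cong (+-cong (+-cong (*-congˡ (^q^0 x)) (*-congˡ (trans (^q^suc x 0) (^q^0 _))))
      (*-congˡ (^q² x))) (*-congˡ (^q³ x))) (*-congˡ (^q⁴ x))
    lower : ∀ i → i ℕ.< 4 → ∀ a → Polynomial (q ℕ.^ 4) 0# (λ x → a * x ^ (q ℕ.^ i))
    lower i i<4 a = polynomial-raise (ℕ.^-monoʳ-< q 1<q i<4) (polynomial-monomial (q ℕ.^ i) a)
    f-polynomial : Polynomial (q ℕ.^ 4) (0# + 0# + 0# + 0# + a₄) f
    f-polynomial =
      polynomial-+ (q ℕ.^ 4) (polynomial-+ (q ℕ.^ 4) (polynomial-+ (q ℕ.^ 4) (polynomial-+ (q ℕ.^ 4)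
        (lower 0 z<s 1#)
        (lower 1 (s<s z<s) k))
        (lower 2 (s<s (s<s z<s)) a₂))
        (lower 3 (s<s (s<s (s<s z<s))) a₃))
        (polynomial-monomial (q ℕ.^ 4) a₄)
    lead≉0 : ¬ 0# + 0# + 0# + 0# + a₄ ≈ 0#
    lead≉0 lead≈0 = *-nonzero (*-nonzero (*-nonzero k≉0 (σ-nonzero k≉0)) (σ-nonzero (σ-nonzero k≉0)))
      (σ-nonzero (σ-nonzero (σ-nonzero k≉0)))
      (trans (solve 1 (λ a → a := con (+ 0) :+ con (+ 0) :+ con (+ 0) :+ con (+ 0) :+ a) refl a₄) lead≈0)

  -- If ψ had trivial kernel it would be onto, and the trace form would vanish on x.
  kernel-adjoint : ∀ {ρ} {φ ψ : Carrier → Carrier} → ¬ Tr ρ ≈ 0# → Additive ψ → (∀ x y → Tr (y * φ x) ≈ Tr (ψ y * x)) →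
    ∀ {x} → ¬ x ≈ 0# → φ x ≈ 0# → ∃ λ y → ¬ y ≈ 0# × ψ y ≈ 0#
  kernel-adjoint {ρ} {φ} {ψ} Trρ≉0 ψ-additive adjoint {x} x≉0 φx≈0
    with ∃? {P = λ y → ¬ y ≈ 0# × ψ y ≈ 0#}
      (λ y≈z (y≉0 , ψy≈0) → (λ z≈0 → y≉0 (trans y≈z z≈0)) , trans (f-cong ψ-additive (sym y≈z)) ψy≈0)
      (λ y → ¬? (y ≟ 0#) ×-dec (ψ y ≟ 0#))
  ... | yes found = found
  ... | no  none  = contradiction Trρ≈0 Trρ≉0
    where
    x⁻¹   = proj₁ (inverse x x≉0)
    xx⁻¹≈1 = proj₂ (inverse x x≉0)
    -- The target is chosen so that `ψ y * x = ρ`, an element of nonzero trace.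
    preimage = endomap-surjective ψ (f-cong ψ-additive) (f-injective ψ-additive
      (λ {y} ψy≈0 → decidable-stable (y ≟ 0#) (λ y≉0 → none (y , y≉0 , ψy≈0)))) (ρ * x⁻¹)
    y = proj₁ preimage
    Trρ≈0 : Tr ρ ≈ 0#
    Trρ≈0 = begin
      Tr ρ                  ≈⟨ Tr-cong (trans (*-congˡ xx⁻¹≈1) (*-identityʳ ρ)) ⟨
      Tr (ρ * (x * x⁻¹))    ≈⟨ Tr-cong (solve 3 (λ r x z → r :* (x :* z) := r :* z :* x) refl ρ x x⁻¹) ⟩
      Tr (ρ * x⁻¹ * x)      ≈⟨ Tr-cong (*-congʳ (proj₂ preimage)) ⟨
      Tr (ψ y * x)          ≈⟨ adjoint x y ⟨
      Tr (y * φ x)          ≈⟨ Tr-cong (trans (*-congˡ φx≈0) (zeroʳ y)) ⟩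
      Tr 0#                 ≈⟨ f-0 Tr-additive ⟩
      0#                    ∎

  -- Projectivities acting on linear sets, and the normal form `V`.

  applyᵥ-cong : ∀ φ {u v} → u ≈ᵥ v → applyᵥ φ u ≈ᵥ applyᵥ φ v
  applyᵥ-cong φ (eq₁ , eq₂) = +-cong (*-congˡ eq₁) (*-congˡ eq₂) , +-cong (*-congˡ eq₁) (*-congˡ eq₂)

  ≈ᵥ-trans : ∀ {u v w} → u ≈ᵥ v → v ≈ᵥ w → u ≈ᵥ w
  ≈ᵥ-trans (p , q) (p′ , q′) = trans p p′ , trans q q′

  ≈ᵥ-sym : ∀ {u v} → u ≈ᵥ v → v ≈ᵥ u
  ≈ᵥ-sym (p , q) = sym p , sym q

  L-mono : ∀ {U V} → U ⊆ V → L U ⊆ L V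
  L-mono U⊆V (u , u∈U , P∼u) = u , U⊆V u∈U , P∼u

  image-L : ∀ φ {U V} → (∀ {u} → u ∈ U → applyᵥ φ u ∈ V) →
    (∀ {v} → v ∈ V → ∃ λ u → u ∈ U × v ≈ᵥ applyᵥ φ u) → image φ (L U) ≐ L V
  image-L φ {U} {V} onto-V from-U = (λ {Q} → ⊆-dir {Q}) , (λ {Q} → ⊇-dir {Q})
    where
    rescale : ∀ t s {m n u v x y} → x ≈ s * u → y ≈ s * v → t * (m * x + n * y) ≈ t * s * (m * u + n * v)
    rescale t s {m} {n} {u} {v} x≈su y≈sv = trans (*-congˡ (+-cong (*-congˡ x≈su) (*-congˡ y≈sv)))
      (solve 6 (λ t s m n u v → t :* (m :* (s :* u) :+ n :* (s :* v)) := t :* s :* (m :* u :+ n :* v)) refl t s m n u v)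
    ⊆-dir : image φ (L U) ⊆ L V
    ⊆-dir (P , (u , u∈U , u≉0 , s , s≉0 , P₁≈ , P₂≈) , t , t≉0 , Q₁≈ , Q₂≈) =
      applyᵥ φ u , onto-V u∈U , applyᵥ-nonzero φ u u≉0 , t * s , *-nonzero t≉0 s≉0 ,
      trans Q₁≈ (rescale t s P₁≈ P₂≈) , trans Q₂≈ (rescale t s P₁≈ P₂≈)
    ⊇-dir : L V ⊆ image φ (L U)
    ⊇-dir (v , v∈V , v≉0 , s , s≉0 , Q₁≈ , Q₂≈) =
      let (u , u∈U , v₁≈ , v₂≈) = from-U v∈V
          u≉0 : ¬ u ≈ᵥ 0ᵥ
          u≉0 u≈0 = v≉0 (≈ᵥ-trans (v₁≈ , v₂≈) (≈ᵥ-trans (applyᵥ-cong φ u≈0) (applyᵥ-0)))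
      in ⟨ u ∣ u≉0 ⟩ , (u , u∈U , u≉0 , 1# , 1≉0 , sym (*-identityˡ _) , sym (*-identityˡ _)) ,
         s , s≉0 , trans Q₁≈ (*-congˡ v₁≈) , trans Q₂≈ (*-congˡ v₂≈)
      where
      applyᵥ-0 : applyᵥ φ 0ᵥ ≈ᵥ 0ᵥ
      applyᵥ-0 = trans (+-cong (zeroʳ _) (zeroʳ _)) (+-identityʳ 0#) , trans (+-cong (zeroʳ _) (zeroʳ _)) (+-identityʳ 0#)

  -- The common shape of W⁰ (θ = 0) and W¹ (θ ≠ 0).
  V : (δ θ : Carrier) → Pred Vector (c ⊔ ℓ)
  V δ θ u = ∃₂ λ x h → h ∈ 𝔽q × Tr x ≈ θ * h × u ≈ᵥ (x , σ x + δ * h)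

  -- For invertible `θ` the trace condition determines `h = τ * Tr x`; conversely this value is a
  -- legitimate `h` because `τ`, the inverse of an element of `𝔽q`, lies in `𝔽q`.
  V-normalise : ∀ {δ θ} → ¬ δ ≈ 0# → θ ∈ 𝔽q → Σ (Fin 2) λ ε → Σ Carrier λ γ → ¬ γ ≈ 0# × V δ θ ≐ W ε γ
  V-normalise {δ} {θ} δ≉0 θ∈𝔽q with θ ≟ 0#
  ... | yes θ≈0 = zero , δ , δ≉0 ,
    (λ (x , h , h∈𝔽q , Trx≈θh , u≈) → x , h , trans Trx≈θh (trans (*-congʳ θ≈0) (zeroˡ h)) , h∈𝔽q , u≈) ,
    (λ (x , h , Trx≈0 , h∈𝔽q , u≈) → x , h , h∈𝔽q , trans Trx≈0 (sym (trans (*-congʳ θ≈0) (zeroˡ h))) , u≈)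
  ... | no  θ≉0 = suc zero , δ * τ , *-nonzero δ≉0 (inverse-nonzero θτ≈1) ,
    (λ (x , h , h∈𝔽q , Trx≈θh , u₁≈ , u₂≈) → x , u₁≈ , trans u₂≈ (+-congˡ (begin
      δ * h                ≈⟨ *-congʳ (trans (*-congˡ θτ≈1) (*-identityʳ δ)) ⟨
      δ * (θ * τ) * h      ≈⟨ solve 4 (λ d t s h → d :* (t :* s) :* h := d :* s :* (t :* h)) refl δ θ τ h ⟩
      δ * τ * (θ * h)      ≈⟨ *-congˡ Trx≈θh ⟨
      δ * τ * Tr x         ∎))) ,
    (λ (x , u₁≈ , u₂≈) → x , τ * Tr x , trans (σ-* τ (Tr x)) (*-cong τ∈𝔽q (σ-Tr x)) ,
      trans (sym (*-identityˡ _)) (trans (*-congʳ (sym θτ≈1)) (*-assoc θ τ (Tr x))) ,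
      u₁≈ , trans u₂≈ (+-congˡ (*-assoc δ τ (Tr x))))
    where
    τ    = proj₁ (inverse θ θ≉0)
    θτ≈1 = proj₂ (inverse θ θ≉0)
    τ∈𝔽q : τ ∈ 𝔽q
    τ∈𝔽q = *-cancelˡ θ≉0 (begin
      θ * σ τ        ≈⟨ *-congʳ θ∈𝔽q ⟨
      σ θ * σ τ      ≈⟨ σ-* θ τ ⟨
      σ (θ * τ)      ≈⟨ trans (σ-cong θτ≈1) σ-1 ⟩
      1#             ≈⟨ θτ≈1 ⟨
      θ * τ          ∎)

  EquivalentToSomeW : PointSet → Set (c ⊔ ℓ)
  EquivalentToSomeW X = Σ (Fin 2) λ ε → Σ Carrier λ γ → ¬ γ ≈ 0# × ProjectivelyEquivalent X (L (W ε γ))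

  equivalent-via-V : ∀ {X U δ θ} → X ≐ L U → ¬ δ ≈ 0# → θ ∈ 𝔽q → (φ : PGL₂) →
    (∀ {u} → u ∈ U → applyᵥ φ u ∈ V δ θ) →
    (∀ {v} → v ∈ V δ θ → ∃ λ u → u ∈ U × v ≈ᵥ applyᵥ φ u) → EquivalentToSomeW X
  equivalent-via-V (X⊆LU , LU⊆X) δ≉0 θ∈𝔽q φ onto-V from-U =
    let (ε , γ , γ≉0 , V⊆W , W⊆V) = V-normalise δ≉0 θ∈𝔽q
        (image⊆LV , LV⊆image)     = image-L φ onto-V from-U
    in ε , γ , γ≉0 , φ ,
       (λ {Q} (P , P∈X , Q∼φP) → L-mono V⊆W {Q} (image⊆LV {Q} (P , X⊆LU P∈X , Q∼φP))) ,
       (λ {Q} Q∈LW → let (P , P∈LU , Q∼φP) = LV⊆image {Q} (L-mono W⊆V {Q} Q∈LW) in P , LU⊆X P∈LU , Q∼φP)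

  -- Family (C4): an explicit matrix onto `V`.

  neg-nonzero : ∀ {x} → ¬ x ≈ 0# → ¬ - x ≈ 0#
  neg-nonzero x≉0 -x≈0 = x≉0 (trans (sym (-‿involutive _)) (trans (-‿cong -x≈0) -0#≈0#))

  -- For w = x + σ² x one has x = Tr x − σ w − σ² w and the second coordinate of U₄ is k σ w + σ² w.
  -- Hilbert's theorem 90 gives a ≠ 0 with k σ a = a; scaling the second coordinate by σ a turns it into
  -- a σ w + σ a σ² w, and φ eliminates σ² w from one coordinate and σ w from the other.
  C4-equivalent : ∀ {X} → C4 X → EquivalentToSomeW X
  C4-equivalent {X} (k , Nk≈1 , k≉1 , X≐LU) = equivalent-via-V X≐LU δ≉0 θ∈𝔽q φ onto-V from-U
    where
    a : Carrier
    a = proj₁ (hilbert90 Nk≈1)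
    a≉0 : ¬ a ≈ 0#
    a≉0 = proj₁ (proj₂ (hilbert90 Nk≈1))
    kσa≈a : k * σ a ≈ a
    kσa≈a = proj₂ (proj₂ (hilbert90 Nk≈1))
    σa≉a : ¬ σ a ≈ a
    σa≉a σa≈a = k≉1 (*-cancelˡ a≉0 (begin
      a * k       ≈⟨ *-comm a k ⟩
      k * a       ≈⟨ *-congˡ σa≈a ⟨
      k * σ a     ≈⟨ kσa≈a ⟩
      a           ≈⟨ *-identityʳ a ⟨
      a * 1#      ∎))
    D≉0 : ¬ σ a - a ≈ 0#
    D≉0 D≈0 = σa≉a (x∙y⁻¹≈ε⇒x≈y _ _ D≈0)
    d = proj₁ (inverse (σ a - a) D≉0)
    Dd≈1 : (σ a - a) * d ≈ 1#
    Dd≈1 = proj₂ (inverse (σ a - a) D≉0)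
    -- Dividing by `σ a - a` gives `b = g + 1` and `b * k = g`, so the rows of `φ` produce
    -- `σ w - b Tr x` and `σ² w + g Tr x`. Writing the second as `σ` of the first plus `δ Tr x`
    -- dictates `δ`; the trace of the first dictates `θ`, where the 2 comes from `Tr w = 2 Tr x`.
    g b δ θ : Carrier
    g = a * d
    b = σ a * d
    δ = g + σ b
    θ = 1# + 1# - Tr b
    b≈g+1 : b ≈ g + 1#
    b≈g+1 = begin
      σ a * d                      ≈⟨ solve 3 (λ a a₁ d → a₁ :* d := a :* d :+ (a₁ :- a) :* d) refl a (σ a) d ⟩
      a * d + (σ a - a) * d        ≈⟨ +-congˡ Dd≈1 ⟩
      a * d + 1#                   ∎
    bk≈g : b * k ≈ g
    bk≈g = trans (solve 3 (λ a₁ d k → a₁ :* d :* k := k :* a₁ :* d) refl (σ a) d k) (*-congʳ kσa≈a)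
    b≉0 : ¬ b ≈ 0#
    b≉0 = *-nonzero (σ-nonzero a≉0) (inverse-nonzero Dd≈1)
    θ∈𝔽q : θ ∈ 𝔽q
    θ∈𝔽q = trans (f-sub σ-additive _ _) (+-cong (trans (f-+ σ-additive 1# 1#) (+-cong σ-1 σ-1)) (-‿cong (σ-Tr b)))
    -- Clearing the denominators `σ a - a` and `σ² a - σ a` turns `δ` into `σ a * (σ² a - a)`.
    δ≉0 : ¬ δ ≈ 0#
    δ≉0 δ≈0 = σa≉a (σ²-fixed (x∙y⁻¹≈ε⇒x≈y _ _ (x≉0∧xy≈0⇒y≈0 (σ-nonzero a≉0) (begin
      a₁ * (a₂ - a)                                                 ≈⟨ solve 3 (λ a a₁ a₂ → a₁ :* (a₂ :- a) := a :* (a₂ :- a₁) :+ a₂ :* (a₁ :- a)) refl a a₁ a₂ ⟩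
      a * (a₂ - a₁) + a₂ * (a₁ - a)                                 ≈⟨ +-cong (*-congʳ (trans (*-congˡ Dd≈1) (*-identityʳ a)))
                                                                         (*-congʳ (trans (*-congˡ σDσd≈1) (*-identityʳ a₂))) ⟨
      a * ((a₁ - a) * d) * (a₂ - a₁) + a₂ * ((a₂ - a₁) * d₁) * (a₁ - a)
                                                                    ≈⟨ solve 5 (λ a a₁ a₂ d d₁ → a :* ((a₁ :- a) :* d) :* (a₂ :- a₁) :+ a₂ :* ((a₂ :- a₁) :* d₁) :* (a₁ :- a)
                                                                         := (a :* d :+ a₂ :* d₁) :* ((a₁ :- a) :* (a₂ :- a₁))) refl a a₁ a₂ d d₁ ⟩
      (a * d + a₂ * d₁) * ((a₁ - a) * (a₂ - a₁))                    ≈⟨ *-congʳ (+-congˡ (σ-* a₁ d)) ⟨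
      δ * ((a₁ - a) * (a₂ - a₁))                                    ≈⟨ trans (*-congʳ δ≈0) (zeroˡ _) ⟩
      0#                                                            ∎))))
      where
      a₁ = σ a
      a₂ = σ² a
      d₁ = σ d
      σDσd≈1 : (a₂ - a₁) * d₁ ≈ 1#
      σDσd≈1 = trans (*-congʳ (sym (f-sub σ-additive a₁ a))) (trans (sym (σ-* (a₁ - a) d)) (trans (σ-cong Dd≈1) σ-1))
    φ : PGL₂
    φ = record
      { m₁₁ = - b ; m₁₂ = - b ; m₂₁ = g ; m₂₂ = b
      -- The determinant is `- b * (b - g)`, that is, `- b`.
      ; det≉0 = λ det≈0 → neg-nonzero b≉0 (begin
          - b                          ≈⟨ *-identityʳ (- b) ⟨
          - b * 1#                     ≈⟨ *-congˡ Dd≈1 ⟨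
          - b * ((σ a - a) * d)        ≈⟨ solve 3 (λ a a₁ d → (:- (a₁ :* d)) :* ((a₁ :- a) :* d)
                                            := (:- (a₁ :* d)) :* (a₁ :* d) :- (:- (a₁ :* d)) :* (a :* d)) refl a (σ a) d ⟩
          - b * b - - b * g            ≈⟨ det≈0 ⟩
          0#                           ∎)
      }
    w : Carrier → Carrier
    w x = x + σ² x
    σw : ∀ x → σ (w x) ≈ σ x + σ³ x
    σw x = f-+ σ-additive x (σ² x)
    σ²w : ∀ x → σ² (w x) ≈ σ² x + σ⁴ x
    σ²w x = f-+ σ²-additive x (σ² x)
    point : Carrier → Carrier → Vector
    point y h = y , σ y + δ * h
    point-cong : ∀ {y y′ h h′} → y ≈ y′ → h ≈ h′ → point y h ≈ᵥ point y′ h′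
    point-cong y≈y′ h≈h′ = y≈y′ , +-cong (σ-cong y≈y′) (*-congˡ h≈h′)
    U₄-vector : Carrier → Vector
    U₄-vector x = x , k * (x ^ q + x ^ (q ℕ.^ 3)) + x ^ (q ℕ.^ 2) + x ^ (q ℕ.^ 4)
    φ-vector : ∀ x → applyᵥ φ (U₄-vector x) ≈ᵥ point (σ (w x) - b * Tr x) (Tr x)
    φ-vector x = trans (+-congˡ (*-congˡ y≈)) first , trans (+-congˡ (*-congˡ y≈)) second
      where
      x₁ = σ x
      x₂ = σ² x
      x₃ = σ³ x
      x₄ = σ⁴ x
      y≈ : k * (x ^ q + x ^ (q ℕ.^ 3)) + x ^ (q ℕ.^ 2) + x ^ (q ℕ.^ 4) ≈ k * (x₁ + x₃) + x₂ + x₄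
      y≈ = +-cong (+-cong (*-congˡ (+-congˡ (^q³ x))) (^q² x)) (^q⁴ x)
      first : - b * x + - b * (k * (x₁ + x₃) + x₂ + x₄) ≈ σ (w x) - b * Tr x
      first = begin
        - b * x + - b * (k * (x₁ + x₃) + x₂ + x₄)
          ≈⟨ solve 7 (λ b k x x₁ x₂ x₃ x₄ → (:- b) :* x :+ (:- b) :* (k :* (x₁ :+ x₃) :+ x₂ :+ x₄)
               := :- (b :* (x :+ x₂ :+ x₄)) :- b :* k :* (x₁ :+ x₃)) refl b k x x₁ x₂ x₃ x₄ ⟩
        - (b * (x + x₂ + x₄)) - b * k * (x₁ + x₃)
          ≈⟨ +-congˡ (-‿cong (*-congʳ bk≈g)) ⟩
        - (b * (x + x₂ + x₄)) - g * (x₁ + x₃)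
          ≈⟨ solve 7 (λ b g x x₁ x₂ x₃ x₄ → :- (b :* (x :+ x₂ :+ x₄)) :- g :* (x₁ :+ x₃)
               := x₁ :+ x₃ :- (b :* (x :+ x₂ :+ x₄) :+ (g :+ con (+ 1)) :* (x₁ :+ x₃))) refl b g x x₁ x₂ x₃ x₄ ⟩
        -- The solver's constant `con (+ 1)` evaluates to `1# + 0#`, hence this spelling of 1.
        x₁ + x₃ - (b * (x + x₂ + x₄) + (g + (1# + 0#)) * (x₁ + x₃))
          ≈⟨ +-congˡ (-‿cong (+-congˡ (*-congʳ (trans b≈g+1 (+-congˡ (sym (+-identityʳ 1#))))))) ⟨
        x₁ + x₃ - (b * (x + x₂ + x₄) + b * (x₁ + x₃))
          ≈⟨ solve 6 (λ b x x₁ x₂ x₃ x₄ → x₁ :+ x₃ :- (b :* (x :+ x₂ :+ x₄) :+ b :* (x₁ :+ x₃))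
               := x₁ :+ x₃ :- b :* (x :+ x₁ :+ x₂ :+ x₃ :+ x₄)) refl b x x₁ x₂ x₃ x₄ ⟩
        x₁ + x₃ - b * (x + x₁ + x₂ + x₃ + x₄)
          ≈⟨ +-cong (σw x) (-‿cong (*-congˡ (Tr-expand x))) ⟨
        σ (w x) - b * Tr x ∎
      second : g * x + b * (k * (x₁ + x₃) + x₂ + x₄) ≈ σ (σ (w x) - b * Tr x) + δ * Tr x
      second = begin
        g * x + b * (k * (x₁ + x₃) + x₂ + x₄)
          ≈⟨ solve 8 (λ b g k x x₁ x₂ x₃ x₄ → g :* x :+ b :* (k :* (x₁ :+ x₃) :+ x₂ :+ x₄)
               := g :* x :+ b :* k :* (x₁ :+ x₃) :+ b :* (x₂ :+ x₄)) refl b g k x x₁ x₂ x₃ x₄ ⟩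
        g * x + b * k * (x₁ + x₃) + b * (x₂ + x₄)
          ≈⟨ +-cong (+-congˡ (*-congʳ bk≈g)) (*-congʳ (trans b≈g+1 (+-congˡ (sym (+-identityʳ 1#))))) ⟩
        g * x + g * (x₁ + x₃) + (g + (1# + 0#)) * (x₂ + x₄)
          ≈⟨ solve 6 (λ g x x₁ x₂ x₃ x₄ → g :* x :+ g :* (x₁ :+ x₃) :+ (g :+ con (+ 1)) :* (x₂ :+ x₄)
               := x₂ :+ x₄ :+ g :* (x :+ x₁ :+ x₂ :+ x₃ :+ x₄)) refl g x x₁ x₂ x₃ x₄ ⟩
        x₂ + x₄ + g * (x + x₁ + x₂ + x₃ + x₄)
          ≈⟨ +-cong (σ²w x) (*-congˡ (Tr-expand x)) ⟨
        σ² (w x) + g * Tr x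
          ≈⟨ solve 4 (λ s g b t → s :+ g :* t := s :- b :* t :+ (g :+ b) :* t) refl (σ² (w x)) g (σ b) (Tr x) ⟩
        σ² (w x) - σ b * Tr x + δ * Tr x
          ≈⟨ +-congʳ (trans (f-sub σ-additive _ _) (+-congˡ (-‿cong (trans (σ-* b (Tr x)) (*-congˡ (σ-Tr x)))))) ⟨
        σ (σ (w x) - b * Tr x) + δ * Tr x ∎
    onto-V : ∀ {u} → u ∈ U₄ k → applyᵥ φ u ∈ V δ θ
    onto-V (x , u≈) = σ (w x) - b * Tr x , Tr x , σ-Tr x , (begin
      Tr (σ (w x) - b * Tr x)              ≈⟨ f-sub Tr-additive _ _ ⟩
      Tr (σ (w x)) - Tr (b * Tr x)         ≈⟨ +-cong (trans (Tr-σ (w x)) (trans (f-+ Tr-additive x (σ² x)) (+-congˡ (trans (Tr-σ (σ x)) (Tr-σ x)))))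
                                                (-‿cong (trans (Tr-cong (*-comm b (Tr x))) (Tr-scale (σ-Tr x) b))) ⟩
      Tr x + Tr x - Tr x * Tr b            ≈⟨ +-congʳ (+-cong (*-identityˡ _) (*-identityˡ _)) ⟨
      1# * Tr x + 1# * Tr x - Tr x * Tr b  ≈⟨ solve 3 (λ o t s → o :* t :+ o :* t :- t :* s := (o :+ o :- s) :* t) refl 1# (Tr x) (Tr b) ⟩
      θ * Tr x                             ∎) , ≈ᵥ-trans (applyᵥ-cong φ u≈) (φ-vector x)
    from-U : ∀ {v} → v ∈ V δ θ → ∃ λ u → u ∈ U₄ k × v ≈ᵥ applyᵥ φ u
    from-U (y , h , h∈𝔽q , Try≈θh , v≈) = U₄-vector x , (x , refl , refl) ,
      ≈ᵥ-trans v≈ (≈ᵥ-trans (point-cong y≈ (sym Trx≈h)) (≈ᵥ-sym (φ-vector x)))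
      where
      -- Solving `y = σ w - b h` for `w` gives `z`, since `σ⁴` inverts `σ`; then `x` is recovered
      -- from `x = Tr x - σ w - σ² w` with `Tr x = h`.
      z = σ⁴ (y + b * h)
      x = h - (σ z + σ² z)
      -- This is where the condition `Tr y = θ h` enters: `w x` equals `z + (h + h - Tr z)`.
      Trz≈h+h : z + σ z + σ² z + σ³ z + σ⁴ z ≈ h + h
      Trz≈h+h = begin
        z + σ z + σ² z + σ³ z + σ⁴ z          ≈⟨ Tr-expand z ⟨
        Tr z                                  ≈⟨ trans (sym (Tr-σ z)) (Tr-cong (σ⁵ _)) ⟩
        Tr (y + b * h)                        ≈⟨ trans (f-+ Tr-additive y (b * h)) (+-cong Try≈θh (trans (Tr-cong (*-comm b h)) (Tr-scale h∈𝔽q b))) ⟩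
        θ * h + h * Tr b                      ≈⟨ solve 3 (λ o h t → (o :+ o :- t) :* h :+ h :* t := o :* h :+ o :* h) refl 1# h (Tr b) ⟩
        1# * h + 1# * h                       ≈⟨ +-cong (*-identityˡ h) (*-identityˡ h) ⟩
        h + h                                 ∎
      wx≈z : w x ≈ z
      wx≈z = begin
        x + σ² x                                                        ≈⟨ +-congˡ (trans (f-sub σ²-additive _ _) (+-cong (trans (σ-cong h∈𝔽q) h∈𝔽q) (-‿cong (f-+ σ²-additive _ _)))) ⟩
        h - (σ z + σ² z) + (h - (σ³ z + σ⁴ z))                          ≈⟨ solve 5 (λ h z₁ z₂ z₃ z₄ → h :- (z₁ :+ z₂) :+ (h :- (z₃ :+ z₄))
                                                                             := h :+ h :- (z₁ :+ z₂ :+ z₃ :+ z₄)) refl h (σ z) (σ² z) (σ³ z) (σ⁴ z) ⟩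
        h + h - (σ z + σ² z + σ³ z + σ⁴ z)                              ≈⟨ +-congʳ Trz≈h+h ⟨
        z + σ z + σ² z + σ³ z + σ⁴ z - (σ z + σ² z + σ³ z + σ⁴ z)       ≈⟨ solve 5 (λ z z₁ z₂ z₃ z₄ → z :+ z₁ :+ z₂ :+ z₃ :+ z₄ :- (z₁ :+ z₂ :+ z₃ :+ z₄) := z)
                                                                             refl z (σ z) (σ² z) (σ³ z) (σ⁴ z) ⟩
        z                                                               ∎
      Trx≈h : Tr x ≈ h
      Trx≈h = begin
        Tr x                                        ≈⟨ Tr-expand x ⟩
        x + σ x + σ² x + σ³ x + σ⁴ x                ≈⟨ solve 5 (λ x x₁ x₂ x₃ x₄ → x :+ x₁ :+ x₂ :+ x₃ :+ x₄ := x :+ ((x₁ :+ x₃) :+ (x₂ :+ x₄)))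
                                                         refl x (σ x) (σ² x) (σ³ x) (σ⁴ x) ⟩
        x + ((σ x + σ³ x) + (σ² x + σ⁴ x))          ≈⟨ +-congˡ (+-cong (trans (sym (σw x)) (σ-cong wx≈z)) (trans (sym (σ²w x)) (f-cong σ²-additive wx≈z))) ⟩
        h - (σ z + σ² z) + (σ z + σ² z)             ≈⟨ solve 2 (λ h s → h :- s :+ s := h) refl h (σ z + σ² z) ⟩
        h                                           ∎
      y≈ : y ≈ σ (w x) - b * Tr x
      y≈ = begin
        y                          ≈⟨ solve 2 (λ y s → y := y :+ s :- s) refl y (b * h) ⟩
        y + b * h - b * h          ≈⟨ +-cong (trans (σ-cong wx≈z) (σ⁵ _)) (-‿cong (*-congˡ Trx≈h)) ⟨
        σ (w x) - b * Tr x         ∎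

  -- Family (C3): the orthogonal complement defines the same linear set and is mapped onto `V`.

  proportional : (P : Point) → ∀ {u₁ u₂} (u≉0 : ¬ (u₁ , u₂) ≈ᵥ 0ᵥ) →
    proj₁ (vector P) * u₂ ≈ proj₂ (vector P) * u₁ → P ∼ ⟨ u₁ , u₂ ∣ u≉0 ⟩
  proportional ⟨ p₁ , p₂ ∣ P≉0 ⟩ {u₁} {u₂} u≉0 p₁u₂≈p₂u₁ with u₁ ≟ 0#
  ... | no u₁≉0 = p₁ * s , (λ p₁s≈0 → P≉0 (p≈0 p₁s≈0)) , sym p₁≈ , sym p₂≈
    where
    s     = proj₁ (inverse u₁ u₁≉0)
    u₁s≈1 = proj₂ (inverse u₁ u₁≉0)
    p₁≈ : p₁ * s * u₁ ≈ p₁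
    p₁≈ = trans (solve 3 (λ p s u → p :* s :* u := p :* (u :* s)) refl p₁ s u₁) (trans (*-congˡ u₁s≈1) (*-identityʳ p₁))
    p₂≈ : p₁ * s * u₂ ≈ p₂
    p₂≈ = begin
      p₁ * s * u₂       ≈⟨ solve 3 (λ p s u → p :* s :* u := p :* u :* s) refl p₁ s u₂ ⟩
      p₁ * u₂ * s       ≈⟨ *-congʳ p₁u₂≈p₂u₁ ⟩
      p₂ * u₁ * s       ≈⟨ trans (*-assoc p₂ u₁ s) (trans (*-congˡ u₁s≈1) (*-identityʳ p₂)) ⟩
      p₂                ∎
    p≈0 : p₁ * s ≈ 0# → (p₁ , p₂) ≈ᵥ 0ᵥ
    p≈0 p₁s≈0 = trans (sym p₁≈) (trans (*-congʳ p₁s≈0) (zeroˡ u₁)) , trans (sym p₂≈) (trans (*-congʳ p₁s≈0) (zeroˡ u₂))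
  -- With `u₁ = 0` the relation forces `p₁ = 0`, so the ratio is read off the second coordinates.
  ... | yes u₁≈0 = p₂ * s , (λ p₂s≈0 → P≉0 (p₁≈0 , trans (sym p₂≈) (trans (*-congʳ p₂s≈0) (zeroˡ u₂)))) ,
      trans p₁≈0 (sym (trans (*-congˡ u₁≈0) (zeroʳ _))) , sym p₂≈
    where
    u₂≉0 : ¬ u₂ ≈ 0#
    u₂≉0 u₂≈0 = u≉0 (u₁≈0 , u₂≈0)
    s     = proj₁ (inverse u₂ u₂≉0)
    u₂s≈1 = proj₂ (inverse u₂ u₂≉0)
    p₂≈ : p₂ * s * u₂ ≈ p₂
    p₂≈ = trans (solve 3 (λ p s u → p :* s :* u := p :* (u :* s)) refl p₂ s u₂) (trans (*-congˡ u₂s≈1) (*-identityʳ p₂))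
    p₁≈0 : p₁ ≈ 0#
    p₁≈0 = x≉0∧xy≈0⇒y≈0 u₂≉0 (trans (*-comm u₂ p₁) (trans p₁u₂≈p₂u₁ (trans (*-congˡ u₁≈0) (zeroʳ p₂))))

  -- The signs are those of the five terms of `ψ`.
  Tr-combination : ∀ a b c d e → Tr (a - b - c + d - e) ≈ Tr a - Tr b - Tr c + Tr d - Tr e
  Tr-combination a b c d e = trans (f-sub Tr-additive _ e) (+-congʳ (trans (f-+ Tr-additive _ d)
    (+-congʳ (trans (f-sub Tr-additive _ c) (+-congʳ (f-sub Tr-additive a b))))))

  module _ {η ρ : Carrier} (η≉0 : ¬ η ≈ 0#) (Trη≈0 : Tr η ≈ 0#) (Trρ≉0 : ¬ Tr ρ ≈ 0#) where
    η⁻¹ : Carrier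
    η⁻¹ = proj₁ (inverse η η≉0)

    ηη⁻¹≈1 : η * η⁻¹ ≈ 1#
    ηη⁻¹≈1 = proj₂ (inverse η η≉0)

    -- The orthogonal complement of U₃ with respect to the alternating form Tr (u₁ v₂ − u₂ v₁); the
    -- parameter ρ does not occur because the first coordinate of U₃ is η (xᵠ − x) plus an arbitrary scalar.
    U₃⊥ : Pred Vector (c ⊔ ℓ)
    U₃⊥ v = ∃₂ λ a h → h ∈ 𝔽q × Tr (η⁻¹ * (a + σ a - h)) ≈ 0# × v ≈ᵥ (a , η⁻¹ * (a + σ a - h))

    f g : Carrier → Carrier
    f x = η * (σ x - x) + Tr (ρ * x)
    g x = σ x - σ⁴ x

    f-additive : Additive f
    f-additive = +-additive (∘-additive (scale-additive η) (+-additive σ-additive (neg-additive id-additive)))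
      (∘-additive Tr-additive (scale-additive ρ))

    g-additive : Additive g
    g-additive = +-additive σ-additive (neg-additive σ⁴-additive)

    -- From `g x = 0` one gets `σ³ x = x`, so `x` lies in `𝔽q`, and there `f x = x * Tr ρ`. Hence
    -- nonzero parameters give nonzero vectors of `U₃`.
    f,g-injective : ∀ {x} → f x ≈ 0# → g x ≈ 0# → x ≈ 0#
    f,g-injective {x} fx≈0 gx≈0 = x≉0∧xy≈0⇒y≈0 Trρ≉0 (begin
      Tr ρ * x                           ≈⟨ *-comm (Tr ρ) x ⟩
      x * Tr ρ                           ≈⟨ Tr-scale σx≈x ρ ⟨
      Tr (x * ρ)                         ≈⟨ Tr-cong (*-comm x ρ) ⟩
      Tr (ρ * x)                         ≈⟨ +-identityˡ _ ⟨
      0# + Tr (ρ * x)                    ≈⟨ +-congʳ (trans (*-congˡ (x≈y⇒x∙y⁻¹≈ε σx≈x)) (zeroʳ η)) ⟨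
      f x                                ≈⟨ fx≈0 ⟩
      0#                                 ∎)
      where
      σx≈x : σ x ≈ x
      σx≈x = σ³-fixed (begin
        σ³ x            ≈⟨ σ⁵ (σ³ x) ⟨
        σ⁴ (σ⁴ x)       ≈⟨ f-cong σ⁴-additive (x∙y⁻¹≈ε⇒x≈y _ _ gx≈0) ⟨
        σ⁴ (σ x)        ≈⟨ σ⁵ x ⟩
        x               ∎)

    -- For p = (p₁ , p₂) the point ⟨p⟩ lies in L U₃ iff φ p has a nonzero kernel, and in L U₃⊥ iff ψ p has.
    φ ψ : Vector → Carrier → Carrier
    φ (p₁ , p₂) x = p₁ * g x - p₂ * f x
    ψ (p₁ , p₂) y = σ⁴ (p₁ * y) - σ (p₁ * y) - σ⁴ (η * (p₂ * y)) + η * (p₂ * y) - ρ * Tr (p₂ * y)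

    φ-additive : ∀ p → Additive (φ p)
    φ-additive (p₁ , p₂) = +-additive (∘-additive (scale-additive p₁) g-additive)
      (neg-additive (∘-additive (scale-additive p₂) f-additive))

    ψ-additive : ∀ p → Additive (ψ p)
    ψ-additive (p₁ , p₂) = +-additive (+-additive (+-additive (+-additive
      (∘-additive σ⁴-additive (scale-additive p₁))
      (neg-additive (∘-additive σ-additive (scale-additive p₁))))
      (neg-additive (∘-additive σ⁴-additive ηp₂-additive)))
      ηp₂-additive)
      (neg-additive (∘-additive (scale-additive ρ) (∘-additive Tr-additive (scale-additive p₂))))
      where
      ηp₂-additive : Additive (λ y → η * (p₂ * y))
      ηp₂-additive = ∘-additive (scale-additive η) (scale-additive p₂)

    -- Powers of `σ` move across by the shift lemmas. For the remaining term, `Tr (ρ * x)` and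
    -- `Tr E` are both scalars in `𝔽q`, so each can be pulled out of the trace and the two
    -- exchanged.
    adjoint : ∀ p x y → Tr (y * φ p x) ≈ Tr (ψ p y * x)
    adjoint (p₁ , p₂) x y = begin
      Tr (y * (p₁ * (σ x - σ⁴ x) - p₂ * (η * (σ x - x) + t)))
        ≈⟨ Tr-cong (solve 8 (λ y p₁ p₂ η x x₁ x₄ t →
             y :* (p₁ :* (x₁ :- x₄) :- p₂ :* (η :* (x₁ :- x) :+ t))
             := p₁ :* y :* x₁ :- p₁ :* y :* x₄ :- η :* (p₂ :* y) :* x₁ :+ η :* (p₂ :* y) :* x :- t :* (p₂ :* y))
             refl y p₁ p₂ η x (σ x) (σ⁴ x) t) ⟩
      Tr (A * σ x - A * σ⁴ x - B * σ x + B * x - t * E)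
        ≈⟨ Tr-combination _ _ _ _ _ ⟩
      Tr (A * σ x) - Tr (A * σ⁴ x) - Tr (B * σ x) + Tr (B * x) - Tr (t * E)
        ≈⟨ +-cong (+-congʳ (+-cong (+-cong (Tr-shift A x) (-‿cong (Tr-shift⁴ A x))) (-‿cong (Tr-shift B x)))) (-‿cong t-swap) ⟩
      Tr (σ⁴ A * x) - Tr (σ A * x) - Tr (σ⁴ B * x) + Tr (B * x) - Tr (Tr E * (ρ * x))
        ≈⟨ Tr-combination _ _ _ _ _ ⟨
      Tr (σ⁴ A * x - σ A * x - σ⁴ B * x + B * x - Tr E * (ρ * x))
        ≈⟨ Tr-cong (solve 7 (λ A₄ A₁ B₄ B x ρ s → A₄ :* x :- A₁ :* x :- B₄ :* x :+ B :* x :- s :* (ρ :* x)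
             := (A₄ :- A₁ :- B₄ :+ B :- ρ :* s) :* x) refl (σ⁴ A) (σ A) (σ⁴ B) B x ρ (Tr E)) ⟩
      Tr ((σ⁴ A - σ A - σ⁴ B + B - ρ * Tr E) * x) ∎
      where
      t = Tr (ρ * x)
      A = p₁ * y
      E = p₂ * y
      B = η * E
      t-swap : Tr (t * E) ≈ Tr (Tr E * (ρ * x))
      t-swap = trans (Tr-scale (σ-Tr (ρ * x)) E) (trans (*-comm t (Tr E)) (sym (Tr-scale (σ-Tr E) (ρ * x))))

    -- Under the trace the first four terms of `ψ` cancel in pairs, leaving `Tr ρ * Tr E = 0` and so
    -- `Tr E = 0`. The equation then reads `σ⁴ h = h` for `h = A + σ A - B`, which puts `h` in `𝔽q`.
    ψ-kernel⇒∈U₃⊥ : ∀ p y → ψ p y ≈ 0# → y ·ᵥ p ∈ U₃⊥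
    ψ-kernel⇒∈U₃⊥ (p₁ , p₂) y ψy≈0 = A , h , σ⁴-fixed σ⁴h≈h , trans (Tr-cong (sym E≈)) TrE≈0 , *-comm y p₁ , trans (*-comm y p₂) E≈
      where
      A = p₁ * y
      E = p₂ * y
      B = η * E
      h = A + σ A - B
      Tr-σ⁴ : ∀ z → Tr (σ⁴ z) ≈ Tr z
      Tr-σ⁴ z = trans (sym (Tr-σ (σ⁴ z))) (Tr-cong (σ⁵ z))
      TrE≈0 : Tr E ≈ 0#
      TrE≈0 = x≉0∧xy≈0⇒y≈0 Trρ≉0 (begin
        Tr ρ * Tr E                                          ≈⟨ solve 4 (λ a b r c → r :* c := :- (a :- a :- b :+ b :- r :* c)) refl (Tr A) (Tr B) (Tr ρ) (Tr E) ⟩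
        - (Tr A - Tr A - Tr B + Tr B - Tr ρ * Tr E)          ≈⟨ -‿cong (+-cong (+-congʳ (+-cong (+-cong (Tr-σ⁴ A) (-‿cong (Tr-σ A))) (-‿cong (Tr-σ⁴ B))))
                                                                  (-‿cong (trans (Tr-cong (*-comm ρ (Tr E))) (trans (Tr-scale (σ-Tr E) ρ) (*-comm (Tr E) (Tr ρ)))))) ⟨
        - (Tr (σ⁴ A) - Tr (σ A) - Tr (σ⁴ B) + Tr B - Tr (ρ * Tr E))
                                                             ≈⟨ -‿cong (Tr-combination _ _ _ _ _) ⟨
        - Tr (ψ (p₁ , p₂) y)                                 ≈⟨ -‿cong (trans (Tr-cong ψy≈0) (f-0 Tr-additive)) ⟩
        - 0#                                                 ≈⟨ -0#≈0# ⟩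
        0#                                                   ∎)
      E≈ : E ≈ η⁻¹ * (A + σ A - h)
      E≈ = begin
        E                              ≈⟨ trans (*-congʳ ηη⁻¹≈1) (*-identityˡ E) ⟨
        η * η⁻¹ * E                    ≈⟨ solve 5 (λ n m c a a₁ → n :* m :* c := m :* (a :+ a₁ :- (a :+ a₁ :- n :* c))) refl η η⁻¹ E A (σ A) ⟩
        η⁻¹ * (A + σ A - h)            ∎
      σ⁴h≈h : σ⁴ h ≈ h
      σ⁴h≈h = x∙y⁻¹≈ε⇒x≈y _ _ (begin
        σ⁴ h - h                                             ≈⟨ +-congʳ (trans (f-sub σ⁴-additive _ _) (+-congʳ (trans (f-+ σ⁴-additive _ _) (+-congˡ (σ⁵ A))))) ⟩
        σ⁴ A + A - σ⁴ B - (A + σ A - B)                      ≈⟨ solve 6 (λ A A₁ A₄ B B₄ s → A₄ :+ A :- B₄ :- (A :+ A₁ :- B) := A₄ :- A₁ :- B₄ :+ B :- s :+ s)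
                                                                  refl A (σ A) (σ⁴ A) B (σ⁴ B) (ρ * Tr E) ⟩
        ψ (p₁ , p₂) y + ρ * Tr E                             ≈⟨ +-cong ψy≈0 (trans (*-congˡ TrE≈0) (zeroʳ ρ)) ⟩
        0# + 0#                                              ≈⟨ +-identityʳ 0# ⟩
        0#                                                   ∎)

    ∈U₃⊥⇒ψ-kernel : ∀ {p₁ p₂ y} → (p₁ * y , p₂ * y) ∈ U₃⊥ → ψ (p₁ , p₂) y ≈ 0#
    ∈U₃⊥⇒ψ-kernel {p₁} {p₂} {y} (a , h , σh≈h , Tr≈0 , A≈a , E≈) = begin
      σ⁴ A - σ A - σ⁴ B + B - ρ * Tr E
        ≈⟨ +-cong (+-cong (+-cong (+-cong (f-cong σ⁴-additive A≈a) (-‿cong (σ-cong A≈a))) (-‿cong σ⁴B≈)) B≈)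
             (-‿cong (trans (*-congˡ (trans (Tr-cong E≈) Tr≈0)) (zeroʳ ρ))) ⟩
      σ⁴ a - σ a - (σ⁴ a + a - h) + (a + σ a - h) - 0#
        ≈⟨ solve 4 (λ a a₁ a₄ h → a₄ :- a₁ :- (a₄ :+ a :- h) :+ (a :+ a₁ :- h) :- con (+ 0) := con (+ 0)) refl a (σ a) (σ⁴ a) h ⟩
      0# ∎
      where
      A = p₁ * y
      E = p₂ * y
      B = η * E
      B≈ : B ≈ a + σ a - h
      B≈ = trans (*-congˡ E≈) (trans (sym (*-assoc η η⁻¹ _)) (trans (*-congʳ ηη⁻¹≈1) (*-identityˡ _)))
      σ⁴h≈h : σ⁴ h ≈ h
      σ⁴h≈h = trans (σ-cong (trans (σ-cong (trans (σ-cong σh≈h) σh≈h)) σh≈h)) σh≈h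
      σ⁴B≈ : σ⁴ B ≈ σ⁴ a + a - h
      σ⁴B≈ = begin
        σ⁴ B                        ≈⟨ f-cong σ⁴-additive B≈ ⟩
        σ⁴ (a + σ a - h)            ≈⟨ f-sub σ⁴-additive _ _ ⟩
        σ⁴ (a + σ a) - σ⁴ h         ≈⟨ +-cong (trans (f-+ σ⁴-additive _ _) (+-congˡ (σ⁵ a))) (-‿cong σ⁴h≈h) ⟩
        σ⁴ a + a - h                ∎

    L-U₃⊆L-U₃⊥ : L (U₃ η ρ) ⊆ L U₃⊥
    L-U₃⊆L-U₃⊥ {P@(⟨ p₁ , p₂ ∣ P≉0 ⟩)} ((u₁ , u₂) , (x , u₁≈ , u₂≈) , u≉0 , s , s≉0 , p₁≈ , p₂≈) =
      let (y , y≉0 , ψy≈0) = kernel-adjoint {φ = φ w} {ψ = ψ w} Trρ≉0 (ψ-additive w) (adjoint w) x≉0 φx≈0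
          v≉0 : ¬ y ·ᵥ w ≈ᵥ 0ᵥ
          v≉0 (v₁≈0 , v₂≈0) = P≉0 (x≉0∧xy≈0⇒y≈0 y≉0 v₁≈0 , x≉0∧xy≈0⇒y≈0 y≉0 v₂≈0)
      in y ·ᵥ w , ψ-kernel⇒∈U₃⊥ w y ψy≈0 , v≉0 ,
         proportional P v≉0 (solve 3 (λ a b y → a :* (y :* b) := b :* (y :* a)) refl p₁ p₂ y)
      where
      w = p₁ , p₂
      u₂≈g : u₂ ≈ g x
      u₂≈g = trans u₂≈ (+-congˡ (-‿cong (^q⁴ x)))
      x≉0 : ¬ x ≈ 0#
      x≉0 x≈0 = u≉0 (trans u₁≈ (trans (f-cong f-additive x≈0) (f-0 f-additive)) ,
                     trans u₂≈g (trans (f-cong g-additive x≈0) (f-0 g-additive)))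
      φx≈0 : φ w x ≈ 0#
      φx≈0 = begin
        p₁ * g x - p₂ * f x                  ≈⟨ +-cong (*-cong p₁≈ (sym u₂≈g)) (-‿cong (*-cong p₂≈ (sym u₁≈))) ⟩
        s * u₁ * u₂ - s * u₂ * u₁            ≈⟨ solve 3 (λ s u v → s :* u :* v :- s :* v :* u := con (+ 0)) refl s u₁ u₂ ⟩
        0#                                   ∎

    -- Symmetry of the trace form lets `φ` and `ψ` exchange roles in `kernel-adjoint`;
    -- `f,g-injective` keeps the resulting vector nonzero.
    L-U₃⊥⊆L-U₃ : L U₃⊥ ⊆ L (U₃ η ρ)
    L-U₃⊥⊆L-U₃ {P@(⟨ p₁ , p₂ ∣ P≉0 ⟩)} ((v₁ , v₂) , (a , h , σh≈h , Tr≈0 , v₁≈ , v₂≈) , v≉0 , s , s≉0 , p₁≈ , p₂≈) =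
      let (x , x≉0 , φx≈0) = kernel-adjoint {φ = ψ w} {ψ = φ w} Trρ≉0 (φ-additive w)
                               (λ y x → trans (Tr-cong (*-comm x (ψ w y))) (trans (sym (adjoint w x y)) (Tr-cong (*-comm y (φ w x))))) y≉0 ψy≈0
          g≈ : σ x - x ^ (q ℕ.^ 4) ≈ g x
          g≈ = +-congˡ (-‿cong (^q⁴ x))
          u≉0 : ¬ (f x , σ x - x ^ (q ℕ.^ 4)) ≈ᵥ 0ᵥ
          u≉0 (fx≈0 , g′x≈0) = x≉0 (f,g-injective fx≈0 (trans (sym g≈) g′x≈0))
      in (f x , σ x - x ^ (q ℕ.^ 4)) , (x , refl , refl) , u≉0 ,
         proportional P u≉0 (trans (*-congˡ g≈) (x∙y⁻¹≈ε⇒x≈y _ _ φx≈0))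
      where
      w = p₁ , p₂
      -- The representative of `P` is `s` times a vector of `U₃⊥`, so this factor scales it back.
      y = proj₁ (inverse s s≉0)
      sy≈1 = proj₂ (inverse s s≉0)
      y≉0 : ¬ y ≈ 0#
      y≉0 = inverse-nonzero sy≈1
      unscale : ∀ {r v} → r ≈ s * v → r * y ≈ v
      unscale {r} {v} r≈sv = begin
        r * y           ≈⟨ *-congʳ r≈sv ⟩
        s * v * y       ≈⟨ solve 3 (λ s v y → s :* v :* y := s :* y :* v) refl s v y ⟩
        s * y * v       ≈⟨ trans (*-congʳ sy≈1) (*-identityˡ v) ⟩
        v               ∎
      ψy≈0 : ψ w y ≈ 0#
      ψy≈0 = ∈U₃⊥⇒ψ-kernel (a , h , σh≈h , Tr≈0 , trans (unscale p₁≈) v₁≈ , trans (unscale p₂≈) v₂≈)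

    -- Chosen so that `Tr (η⁻¹ * (a + σ a)) = Tr (μ * a)`. With `x = μ * a` the condition defining
    -- `U₃⊥` becomes `Tr x = θ h` for `θ = Tr η⁻¹`.
    μ : Carrier
    μ = η⁻¹ + σ⁴ η⁻¹

    -- Applying `σ` to `μ = 0` gives `σ η⁻¹ = - η⁻¹`, hence `σ η = - η`, and the alternating sum of
    -- five terms is `η` itself.
    μ≉0 : ¬ μ ≈ 0#
    μ≉0 μ≈0 = η≉0 (begin
      η                                           ≈⟨ solve 1 (λ n → n := n :+ (:- n) :+ n :+ (:- n) :+ n) refl η ⟩
      η + - η + η + - η + η                       ≈⟨ +-cong (+-cong (+-cong (+-congˡ ση≈-η) σ²η≈η) σ³η≈-η) (trans (σ-cong σ³η≈-η) (trans (f-neg σ-additive η) (trans (-‿cong ση≈-η) (-‿involutive η)))) ⟨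
      η + σ η + σ² η + σ³ η + σ⁴ η                ≈⟨ Tr-expand η ⟨
      Tr η                                        ≈⟨ Trη≈0 ⟩
      0#                                          ∎)
      where
      ση⁻¹≈-η⁻¹ : σ η⁻¹ ≈ - η⁻¹
      ση⁻¹≈-η⁻¹ = +-inverseˡ-unique _ _ (begin
        σ η⁻¹ + η⁻¹                ≈⟨ +-congˡ (σ⁵ η⁻¹) ⟨
        σ η⁻¹ + σ (σ⁴ η⁻¹)         ≈⟨ f-+ σ-additive _ _ ⟨
        σ μ                        ≈⟨ trans (σ-cong μ≈0) (f-0 σ-additive) ⟩
        0#                         ∎)
      ση≈-η : σ η ≈ - η
      ση≈-η = begin
        σ η                                ≈⟨ trans (*-congˡ ηη⁻¹≈1) (*-identityʳ _) ⟨
        σ η * (η * η⁻¹)                    ≈⟨ solve 3 (λ n₁ n m → n₁ :* (n :* m) := :- (n :* (n₁ :* (:- m)))) refl (σ η) η η⁻¹ ⟩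
        - (η * (σ η * - η⁻¹))              ≈⟨ -‿cong (*-congˡ (*-congˡ ση⁻¹≈-η⁻¹)) ⟨
        - (η * (σ η * σ η⁻¹))              ≈⟨ -‿cong (*-congˡ (trans (sym (σ-* η η⁻¹)) (trans (σ-cong ηη⁻¹≈1) σ-1))) ⟩
        - (η * 1#)                         ≈⟨ -‿cong (*-identityʳ η) ⟩
        - η                                ∎
      σ²η≈η : σ² η ≈ η
      σ²η≈η = trans (σ-cong ση≈-η) (trans (f-neg σ-additive η) (trans (-‿cong ση≈-η) (-‿involutive η)))
      σ³η≈-η : σ³ η ≈ - η
      σ³η≈-η = trans (σ-cong σ²η≈η) ση≈-η

    Tr-U₃⊥ : ∀ a {h} → σ h ≈ h → Tr (η⁻¹ * (a + σ a - h)) ≈ Tr (μ * a) - Tr η⁻¹ * h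
    Tr-U₃⊥ a {h} σh≈h = begin
      Tr (η⁻¹ * (a + σ a - h))                            ≈⟨ Tr-cong (solve 4 (λ m a a₁ h → m :* (a :+ a₁ :- h) := m :* a :+ m :* a₁ :- h :* m) refl η⁻¹ a (σ a) h) ⟩
      Tr (η⁻¹ * a + η⁻¹ * σ a - h * η⁻¹)                  ≈⟨ trans (f-sub Tr-additive _ _) (+-congʳ (f-+ Tr-additive _ _)) ⟩
      Tr (η⁻¹ * a) + Tr (η⁻¹ * σ a) - Tr (h * η⁻¹)        ≈⟨ +-cong (+-congˡ (Tr-shift η⁻¹ a)) (-‿cong (trans (Tr-scale σh≈h η⁻¹) (*-comm h (Tr η⁻¹)))) ⟩
      Tr (η⁻¹ * a) + Tr (σ⁴ η⁻¹ * a) - Tr η⁻¹ * h         ≈⟨ +-congʳ (trans (Tr-cong (distribʳ a η⁻¹ (σ⁴ η⁻¹))) (f-+ Tr-additive _ _)) ⟨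
      Tr (μ * a) - Tr η⁻¹ * h                             ∎

    -- On `U₃⊥`, `η` times the second coordinate minus the first is `σ a - h`; the factor `σ μ`
    -- makes this `σ (μ * a) - σ μ * h`, so `δ = - σ μ`.
    U₃⊥→V : PGL₂
    U₃⊥→V = record
      { m₁₁ = μ ; m₁₂ = 0# ; m₂₁ = - σ μ ; m₂₂ = σ μ * η
      ; det≉0 = λ det≈0 → *-nonzero μ≉0 (*-nonzero (σ-nonzero μ≉0) η≉0)
          (trans (solve 3 (λ m m₁ n → m :* (m₁ :* n) := m :* (m₁ :* n) :- con (+ 0) :* (:- m₁)) refl μ (σ μ) η) det≈0)
      }

    U₃⊥→V-vector : ∀ a h → applyᵥ U₃⊥→V (a , η⁻¹ * (a + σ a - h)) ≈ᵥ (μ * a , σ (μ * a) + - σ μ * h)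
    U₃⊥→V-vector a h =
      trans (+-congˡ (zeroˡ _)) (+-identityʳ _) ,
      (begin
        - σ μ * a + σ μ * η * (η⁻¹ * (a + σ a - h))        ≈⟨ solve 6 (λ m a n i a₁ h → (:- m) :* a :+ m :* n :* (i :* (a :+ a₁ :- h))
                                                                 := (:- m) :* a :+ m :* (n :* i) :* (a :+ a₁ :- h)) refl (σ μ) a η η⁻¹ (σ a) h ⟩
        - σ μ * a + σ μ * (η * η⁻¹) * (a + σ a - h)        ≈⟨ +-congˡ (*-congʳ (trans (*-congˡ ηη⁻¹≈1) (*-identityʳ _))) ⟩
        - σ μ * a + σ μ * (a + σ a - h)                    ≈⟨ solve 4 (λ m a a₁ h → (:- m) :* a :+ m :* (a :+ a₁ :- h) := m :* a₁ :+ (:- m) :* h) refl (σ μ) a (σ a) h ⟩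
        σ μ * σ a + - σ μ * h                              ≈⟨ +-congʳ (σ-* μ a) ⟨
        σ (μ * a) + - σ μ * h                              ∎)

    U₃-equivalent : ∀ {X} → X ≐ L (U₃ η ρ) → EquivalentToSomeW X
    U₃-equivalent {X} (X⊆ , ⊆X) = equivalent-via-V
      ((λ {P} P∈X → L-U₃⊆L-U₃⊥ {P} (X⊆ P∈X)) , (λ {P} P∈L → ⊆X (L-U₃⊥⊆L-U₃ {P} P∈L)))
      (neg-nonzero (σ-nonzero μ≉0)) (σ-Tr η⁻¹) U₃⊥→V
      (λ (a , h , σh≈h , Tr≈0 , u≈) → μ * a , h , σh≈h ,
        x∙y⁻¹≈ε⇒x≈y _ _ (trans (sym (Tr-U₃⊥ a σh≈h)) Tr≈0) ,
        ≈ᵥ-trans (applyᵥ-cong U₃⊥→V u≈) (U₃⊥→V-vector a h))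
      (λ (x , h , σh≈h , Trx≈ , v≈) →
        let (m , μm≈1) = inverse μ μ≉0
            a = m * x
            μa≈x : μ * a ≈ x
            μa≈x = trans (sym (*-assoc μ m x)) (trans (*-congʳ μm≈1) (*-identityˡ x))
        in (a , η⁻¹ * (a + σ a - h)) ,
           (a , h , σh≈h , trans (Tr-U₃⊥ a σh≈h) (x≈y⇒x∙y⁻¹≈ε (trans (Tr-cong μa≈x) Trx≈)) , refl , refl) ,
           ≈ᵥ-trans v≈ (≈ᵥ-trans (sym μa≈x , +-congʳ (σ-cong (sym μa≈x))) (≈ᵥ-sym (U₃⊥→V-vector a h))))

  C3-equivalent : ∀ {X} → C3 X → EquivalentToSomeW X
  C3-equivalent (η , ρ , η≉0 , _ , Trη≈0 , Trρ≉0 , X≐LU) = U₃-equivalent η≉0 Trη≈0 Trρ≉0 X≐LU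

open import Data.Nat.Base using (_^_)

proposition2p1 : {c ℓ : Level} (q : ℕ) → IsPrimePower q → (F : FiniteField c ℓ (q ^ 5)) →
    let open FiniteField F
        open LinearSets q F
    in (X : PointSet) → C3 X ⊎ C4 X →
       Σ (Fin 2) λ ε → Σ Carrier λ γ → ¬ (γ ≈ 0#) × ProjectivelyEquivalent X (L (W ε γ))
proposition2p1 q q-primePower F X (inj₁ X∈C3) = LinearSetProperties.C3-equivalent q q-primePower F X∈C3
proposition2p1 q q-primePower F X (inj₂ X∈C4) = LinearSetProperties.C4-equivalent q q-primePower F X∈C4
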